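{- Consider an execution of the DRL transition system, and let $Q$ be a finalized set of snapshots, all taken at or before time $t_f$. Then every actor that has a snapshot in $Q$ is terminated at time $t_f$.
   Context: DRL transition system. Refobs are triples $x: A\to B$ (owner $A$, target $B$, unique token $x$). Facts: $\mathrm{Created}(x)$, $\mathrm{Released}(x)$, $\mathrm{CreatedUsing}(x,y)$, $\mathrm{Activated}(x)$, $\mathrm{Unreleased}(x)$, $\mathrm{SentCount}(x,n)$, $\mathrm{RecvCount}(x,n)$. For a knowledge set (finite set of facts) $\Phi$, $\Phi\vdash\phi$ means derivability in first-order logic plus: absent any $\mathrm{SentCount}(x,n)$, $\Phi\vdash\mathrm{SentCount}(x,0)$; likewise $\mathrm{RecvCount}$; $\Phi\vdash\mathrm{Created}(x)\wedge\neg\mathrm{Released}(x)$ implies $\Phi\vdash\mathrm{Unreleased}(x)$; $\Phi\vdash\mathrm{CreatedUsing}(x,y)$ implies $\Phi\vdash\mathrm{Created}(y)$. Configurations $(\alpha,\mu,\rho,\chi)$: $\alpha$ maps internal actors to knowledge sets (busy or idle), $\mu$ maps actors to multisets of undelivered messages ($\mathrm{app}(x,R)$, $\mathrm{info}(y,z,B)$, $\mathrm{release}(x,n)$), $\rho\subseteq\mathrm{dom}(\alpha)$ receptionists, $\chi$ external actors. Initial configuration: one busy actor $A$ with $\{\mathrm{Activated}(x:A\to E),\mathrm{Created}(y:A\to A),\mathrm{Activated}(y:A\to A)\}$, no messages, $\rho=\emptyset$, $\chi=\{E\}$. Rules: Spawn (busy $A$ spawns fresh $B$ with fresh $x,y$: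 $A$ adds $\mathrm{Activated}(x:A\to B)$, $B$ starts busy with $\{\mathrm{Created}(x),\mathrm{Created}(y:B\to B),\mathrm{Activated}(y)\}$); Send (busy $A$ with $\Phi\vdash\mathrm{Activated}(x:A\to B)$ and $\Phi\vdash\mathrm{Activated}(y_i:A\to C_i)$ and fresh $z_i$: increments send count of $x$, adds $\mathrm{CreatedUsing}(y_i,z_i)$, sends $\mathrm{app}(x,\{z_i:B\to C_i\})$ to $B$); Receive (idle $B$ consumes $\mathrm{app}(x,R)$, becomes busy, increments receive count of $x$, adds $\mathrm{Activated}(z)$ for $z\in R$); Idle (busy becomes idle); SendInfo (busy $A$ removes $\mathrm{CreatedUsing}(y:A\to C,z:B\to C)$, increments send count of $y$, sends $\mathrm{info}(y,z,B)$ to $C$); Info (idle $C$ consumes it, increments receive count of $y$, adds $\mathrm{Created}(z)$); SendRelease (busy $A$ with $\mathrm{Activated}(x:A\to B),\mathrm{SentCount}(x,n)$ and no $\mathrm{CreatedUsing}(x,\cdot)$ removes both facts, deactivating $x$, and sends $\mathrm{release}(x,n)$ to $B$); Release (idle $B$ with $\Phi\vdash\mathrm{RecvCount}(x,n)$ consumes $\mathrm{release}(x,n)$, adds $\mathrm{Released}(x)$, releasing $x$); Compaction (idle $C$ removes $\mathrm{Created}(x)$, $\mathrm{Released}(x)$, $\mathrm{RecvCount}(x,\cdot)$); Snapshot (an idle actor's current knowledge set is recorded as its snapshot); In (a receptionist receives $\mathrm{app}(\bot,R)$ from outside, with fresh refobs it owns whose targets are receptionists or external); Out ($\mathrm{app}$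 messages to external actors are delivered; internal targets of contained refobs become receptionists); ReleaseOut/InfoOut drop control messages to external actors. An execution is a sequence of steps $\kappa_0\to\kappa_1\to\cdots$ from the initial configuration; time $t$ refers to $\kappa_t$. An actor can potentially receive a message in $\kappa$ if some sequence of events (possibly empty) from $\kappa$ leads to a configuration where it has an undelivered message; it is terminated if it is idle and cannot potentially receive a message. A set of snapshots $Q$ has at most one snapshot $\Phi_A$ per actor $A$; write $A\in Q$ if $A$ has a snapshot in $Q$, and $Q\vdash\phi$ if $\Phi\vdash\phi$ for some $\Phi\in Q$. $Q$ is closed if whenever $Q\vdash\mathrm{Unreleased}(x:A\to B)$ and $B\in Q$, then $A\in Q$ and $\Phi_A\vdash\mathrm{Activated}(x)$. $B\in Q$ appears blocked if for every $x:A\to B$ with $Q\vdash\mathrm{Unreleased}(x)$, we have $A,B\in Q$ and $\Phi_A\vdash\mathrm{SentCount}(x,n)$, $\Phi_B\vdash\mathrm{RecvCount}(x,n)$ for some $n$. $Q$ is finalized if it is closed and every actor in $Q$ appears blocked. -}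

module Defs where

open import Data.Nat using (ℕ; zero; suc; _≡ᵇ_; _≤_; _<_)
open import Data.Bool using (Bool; true; false; _∧_; not; if_then_else_; T)
open import Data.List using (List; []; _∷_; _++_; map; filterᵇ)
open import Data.List.Membership.Propositional using (_∈_; _∉_)
open import Data.List.Relation.Unary.All using (All)
open import Data.List.Relation.Unary.Unique.Propositional using (Unique)
open import Data.Maybe using (Maybe; just; nothing; is-just)
open import Data.Product using (Σ; ∃; ∃-syntax; _×_; _,_)
open import Data.Sum using (_⊎_)
open import Relation.Nullary using (¬_)
open import Relation.Binary.PropositionalEquality using (_≡_; _≢_)
open import Relation.Binary.Construct.Closure.ReflexiveTransitive using (Star)

Actor : Set
Actor = ℕ

Token : Set
Token = ℕ

record Refob : Set where
  constructor _∶_⇒_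
  field
    token  : Token
    owner  : Actor
    target : Actor
open Refob public

_==ʳ_ : Refob → Refob → Bool
(x ∶ a ⇒ b) ==ʳ (y ∶ c ⇒ d) = (x ≡ᵇ y) ∧ ((a ≡ᵇ c) ∧ (b ≡ᵇ d))

data Fact : Set where
  Created      : Refob → Fact
  Released     : Refob → Fact
  CreatedUsing : Refob → Refob → Fact
  Activated    : Refob → Fact
  Unreleased   : Refob → Fact
  SentCount    : Refob → ℕ → Fact
  RecvCount    : Refob → ℕ → Fact

_==ᶠ_ : Fact → Fact → Bool
Created x        ==ᶠ Created y        = x ==ʳ y
Released x       ==ᶠ Released y       = x ==ʳ y
CreatedUsing x y ==ᶠ CreatedUsing u v = (x ==ʳ u) ∧ (y ==ʳ v)
Activated x      ==ᶠ Activated y      = x ==ʳ y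
Unreleased x     ==ᶠ Unreleased y     = x ==ʳ y
SentCount x n    ==ᶠ SentCount y m    = (x ==ʳ y) ∧ (n ≡ᵇ m)
RecvCount x n    ==ᶠ RecvCount y m    = (x ==ʳ y) ∧ (n ≡ᵇ m)
_                ==ᶠ _                = false

-- a knowledge set is a finite set of facts, represented by a list
Knowledge : Set
Knowledge = List Fact

-- Derivability  Φ ⊢ φ  (for atomic facts; conjunctions are split by hand)
infix 4 _⊢_
data _⊢_ (Φ : Knowledge) : Fact → Set where
  ax    : ∀ {φ} → φ ∈ Φ → Φ ⊢ φ
  sent0 : ∀ {x} → (∀ n → SentCount x n ∉ Φ) → Φ ⊢ SentCount x 0
  recv0 : ∀ {x} → (∀ n → RecvCount x n ∉ Φ) → Φ ⊢ RecvCount x 0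
  -- Created(x) ∧ ¬Released(x) ⟹ Unreleased(x)  (¬ read closed-world)
  unrel : ∀ {x} → Φ ⊢ Created x → Released x ∉ Φ → Φ ⊢ Unreleased x
  cu    : ∀ {x y} → Φ ⊢ CreatedUsing x y → Φ ⊢ Created y

remove : Fact → Knowledge → Knowledge
remove f = filterᵇ (λ g → not (g ==ᶠ f))

isSentOf : Refob → Fact → Bool
isSentOf x (SentCount y _) = x ==ʳ y
isSentOf x _               = false

isRecvOf : Refob → Fact → Bool
isRecvOf x (RecvCount y _) = x ==ʳ y
isRecvOf x _               = false

removeSent : Refob → Knowledge → Knowledge
removeSent x = filterᵇ (λ g → not (isSentOf x g))

removeRecv : Refob → Knowledge → Knowledge
removeRecv x = filterᵇ (λ g → not (isRecvOf x g))

setSent : Refob → ℕ → Knowledge → Knowledge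
setSent x n Φ = SentCount x n ∷ removeSent x Φ

setRecv : Refob → ℕ → Knowledge → Knowledge
setRecv x n Φ = RecvCount x n ∷ removeRecv x Φ

data Msg : Set where
  app     : Maybe Refob → List Refob → Msg   -- app(x,R); nothing = ⊥
  info    : Refob → Refob → Actor → Msg
  release : Refob → ℕ → Msg

data ActorState : Set where
  busy : Knowledge → ActorState
  idle : Knowledge → ActorState

-- Configurations (α, μ, ρ, χ).  The fields usedTok / usedAct are
-- ghost state recording every token / actor name ever used, so that
-- "fresh" can be expressed as "never used before".
record Config : Set where
  field
    α       : Actor → Maybe ActorState   -- dom α = internal actors
    μ       : Actor → List Msg           -- undelivered messages (multiset)
    ρ       : List Actor                 -- receptionists
    χ       : List Actor                 -- external actors
    usedTok : List Token
    usedAct : List Actor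
open Config public

upd : {X : Set} → (Actor → X) → Actor → X → (Actor → X)
upd f a v b = if b ≡ᵇ a then v else f b

-- initial configuration, for distinct actors A, E and distinct tokens x, y
initConfig : Actor → Actor → Token → Token → Config
initConfig A E x y = record
  { α = λ B → if B ≡ᵇ A
               then just (busy ( Activated (x ∶ A ⇒ E)
                               ∷ Created (y ∶ A ⇒ A)
                               ∷ Activated (y ∶ A ⇒ A) ∷ []))
               else nothing
  ; μ = λ _ → []
  ; ρ = []
  ; χ = E ∷ []
  ; usedTok = x ∷ y ∷ []
  ; usedAct = A ∷ E ∷ []
  }

data Label : Set where
  τ    : Label
  snap : Actor → Knowledge → Label

addMsg : Config → Actor → Msg → (Actor → List Msg)
addMsg κ B m = upd (μ κ) B (m ∷ μ κ B)

setα : Config → Actor → ActorState → (Actor → Maybe ActorState)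
setα κ A s = upd (α κ) A (just s)

-- μ B ≡ ms₁ ++ m ∷ ms₂ : m is one undelivered message of B, and removing
-- it leaves ms₁ ++ ms₂
data Step (κ : Config) : Label → Config → Set where

  spawn : ∀ {A Φ B x y}
    → α κ A ≡ just (busy Φ)
    → B ∉ usedAct κ
    → x ∉ usedTok κ → y ∉ usedTok κ → x ≢ y
    → Step κ τ (record κ
        { α = upd (setα κ A (busy (Activated (x ∶ A ⇒ B) ∷ Φ))) B
                  (just (busy ( Created (x ∶ A ⇒ B)
                              ∷ Created (y ∶ B ⇒ B)
                              ∷ Activated (y ∶ B ⇒ B) ∷ [])))
        ; usedTok = x ∷ y ∷ usedTok κ
        ; usedAct = B ∷ usedAct κ })

  send : ∀ {A Φ x n} (ys : List (Refob × Refob))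
    → α κ A ≡ just (busy Φ)
    → owner x ≡ A
    → Φ ⊢ Activated x
    → All (λ p → let (y , z) = p in
             owner y ≡ A × Φ ⊢ Activated y ×
             owner z ≡ target x × target z ≡ target y ×
             token z ∉ usedTok κ) ys
    → Unique (map (λ p → token (Data.Product.proj₂ p)) ys)
    → Φ ⊢ SentCount x n
    → Step κ τ (record κ
        { α = setα κ A (busy (setSent x (suc n) Φ
                 ++ map (λ p → CreatedUsing (Data.Product.proj₁ p) (Data.Product.proj₂ p)) ys))
        ; μ = addMsg κ (target x) (app (just x) (map Data.Product.proj₂ ys))
        ; usedTok = map (λ p → token (Data.Product.proj₂ p)) ys ++ usedTok κ })

  receive : ∀ {B Φ x R n ms₁ ms₂}
    → α κ B ≡ just (idle Φ)
    → μ κ B ≡ ms₁ ++ app (just x) R ∷ ms₂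
    → Φ ⊢ RecvCount x n
    → Step κ τ (record κ
        { α = setα κ B (busy (setRecv x (suc n) Φ ++ map Activated R))
        ; μ = upd (μ κ) B (ms₁ ++ ms₂) })

  -- receiving an external message app(⊥,R) (no receive count for ⊥)
  receive⊥ : ∀ {B Φ R ms₁ ms₂}
    → α κ B ≡ just (idle Φ)
    → μ κ B ≡ ms₁ ++ app nothing R ∷ ms₂
    → Step κ τ (record κ
        { α = setα κ B (busy (Φ ++ map Activated R))
        ; μ = upd (μ κ) B (ms₁ ++ ms₂) })

  idleStep : ∀ {A Φ}
    → α κ A ≡ just (busy Φ)
    → Step κ τ (record κ { α = setα κ A (idle Φ) })

  sendInfo : ∀ {A Φ y z n}
    → α κ A ≡ just (busy Φ)
    → owner y ≡ A
    → target z ≡ target y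
    → CreatedUsing y z ∈ Φ
    → Φ ⊢ SentCount y n
    → Step κ τ (record κ
        { α = setα κ A (busy (setSent y (suc n) (remove (CreatedUsing y z) Φ)))
        ; μ = addMsg κ (target y) (info y z (owner z)) })

  infoStep : ∀ {C Φ y z B n ms₁ ms₂}
    → α κ C ≡ just (idle Φ)
    → μ κ C ≡ ms₁ ++ info y z B ∷ ms₂
    → Φ ⊢ RecvCount y n
    → Step κ τ (record κ
        { α = setα κ C (idle (setRecv y (suc n) Φ ++ Created z ∷ []))
        ; μ = upd (μ κ) C (ms₁ ++ ms₂) })

  sendRelease : ∀ {A Φ x n}
    → α κ A ≡ just (busy Φ)
    → owner x ≡ A
    → Φ ⊢ Activated x
    → Φ ⊢ SentCount x n
    → (∀ z → CreatedUsing x z ∉ Φ)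
    → Step κ τ (record κ
        { α = setα κ A (busy (remove (SentCount x n) (remove (Activated x) Φ)))
        ; μ = addMsg κ (target x) (release x n) })

  releaseStep : ∀ {B Φ x n ms₁ ms₂}
    → α κ B ≡ just (idle Φ)
    → μ κ B ≡ ms₁ ++ release x n ∷ ms₂
    → Φ ⊢ RecvCount x n
    → Step κ τ (record κ
        { α = setα κ B (idle (Released x ∷ Φ))
        ; μ = upd (μ κ) B (ms₁ ++ ms₂) })

  compaction : ∀ {C Φ x}
    → α κ C ≡ just (idle Φ)
    → Created x ∈ Φ
    → Released x ∈ Φ
    → Step κ τ (record κ
        { α = setα κ C (idle (removeRecv x (remove (Released x) (remove (Created x) Φ)))) })

  snapshot : ∀ {A Φ}
    → α κ A ≡ just (idle Φ)
    → Step κ (snap A Φ) κ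

  inStep : ∀ {A} (R : List Refob)
    → A ∈ ρ κ
    → All (λ z → owner z ≡ A × (target z ∈ ρ κ ⊎ target z ∈ χ κ)
                 × token z ∉ usedTok κ) R
    → Unique (map token R)
    → Step κ τ (record κ
        { μ = addMsg κ A (app nothing R)
        ; usedTok = map token R ++ usedTok κ })

  out : ∀ {E x R ms₁ ms₂}
    → E ∈ χ κ
    → μ κ E ≡ ms₁ ++ app x R ∷ ms₂
    → Step κ τ (record κ
        { μ = upd (μ κ) E (ms₁ ++ ms₂)
        ; ρ = ρ κ ++ filterᵇ (λ C → is-just (α κ C)) (map target R) })

  releaseOut : ∀ {E x n ms₁ ms₂}
    → E ∈ χ κ
    → μ κ E ≡ ms₁ ++ release x n ∷ ms₂
    → Step κ τ (record κ { μ = upd (μ κ) E (ms₁ ++ ms₂) })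

  infoOut : ∀ {E y z B ms₁ ms₂}
    → E ∈ χ κ
    → μ κ E ≡ ms₁ ++ info y z B ∷ ms₂
    → Step κ τ (record κ { μ = upd (μ κ) E (ms₁ ++ ms₂) })

record Execution (A₀ E₀ : Actor) (x₀ y₀ : Token) : Set where
  field
    len   : ℕ
    conf  : ℕ → Config
    label : ℕ → Label
    start : conf 0 ≡ initConfig A₀ E₀ x₀ y₀
    steps : ∀ t → t < len → Step (conf t) (label t) (conf (suc t))
open Execution public

AnyStep : Config → Config → Set
AnyStep κ κ' = ∃[ ℓ ] Step κ ℓ κ'

Reach : Config → Config → Set
Reach = Star AnyStep

HasUndelivered : Config → Actor → Set
HasUndelivered κ A = ∃[ m ] ∃[ ms ] μ κ A ≡ m ∷ ms

PotentiallyReceives : Config → Actor → Set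
PotentiallyReceives κ A = ∃[ κ' ] Reach κ κ' × HasUndelivered κ' A

IsIdle : Config → Actor → Set
IsIdle κ A = ∃[ Φ ] α κ A ≡ just (idle Φ)

Terminated : Config → Actor → Set
Terminated κ A = IsIdle κ A × ¬ PotentiallyReceives κ A

Snapshots : Set
Snapshots = Actor → Maybe Knowledge

_∈Q_ : Actor → Snapshots → Set
A ∈Q Q = ∃[ Φ ] Q A ≡ just Φ

infix 4 _⊢Q_
_⊢Q_ : Snapshots → Fact → Set
Q ⊢Q φ = ∃[ A ] ∃[ Φ ] Q A ≡ just Φ × Φ ⊢ φ

Closed : Snapshots → Set
Closed Q = ∀ x → Q ⊢Q Unreleased x → target x ∈Q Q →
           ∃[ ΦA ] Q (owner x) ≡ just ΦA × ΦA ⊢ Activated x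

AppearsBlocked : Snapshots → Actor → Set
AppearsBlocked Q B = B ∈Q Q ×
  (∀ x → target x ≡ B → Q ⊢Q Unreleased x →
     ∃[ ΦA ] ∃[ ΦB ] ∃[ n ]
       Q (owner x) ≡ just ΦA × Q B ≡ just ΦB ×
       ΦA ⊢ SentCount x n × ΦB ⊢ RecvCount x n)

Finalized : Snapshots → Set
Finalized Q = Closed Q × (∀ B → B ∈Q Q → AppearsBlocked Q B)

TakenBy : ∀ {A₀ E₀ x₀ y₀} → Execution A₀ E₀ x₀ y₀ → Snapshots → ℕ → Set
TakenBy ex Q tf = ∀ A Φ → Q A ≡ just Φ →
  ∃[ t ] t ≤ tf × t < len ex × label ex t ≡ snap A Φ

{-# OPTIONS --safe #-}
module Submission where

-- Follow a single refob x.  It is carried by a message, then activated, then being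
-- released, then released, and while it is activated or being released its send count
-- is its receive count plus the number of messages in transit.  Whenever x is alive and
-- its target B is not a receptionist, a chain of creation records (CreatedUsing facts and
-- info messages in transit to B) leads from a refob that B knows to be created to x;
-- a receptionist has such a chain to a refob owned by an external actor.
--
-- Now suppose that at some time every actor of Q past its snapshot has changed by
-- compaction only, and that B is one of them.  Walking along a chain to B, closedness and
-- blockedness of Q put every owner in Q, with a send count that B had already received
-- at its own snapshot.  Send counts never decrease while a refob is activated, so nothing
-- is in transit along the chain, whether the owner's snapshot is earlier or later.  Hence
-- B is not a receptionist and has no undelivered message, so its next step is again a
-- compaction or a snapshot.  After t_f the same argument applies to every reachable
-- configuration.

-- The snapshots need not form a consistent cut: at a given time some owners on a chain are already
-- frozen while others have yet to be recorded. Both cases take one shape, the relation `Evolved`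
-- from the current knowledge to the snapshot. A past snapshot differs from the present by
-- compaction only, which touches no sender fact; a future one is reached by steps that can only
-- raise the send count of a refob that stays activated. A count that really is raised later is
-- refuted by the count equation, because `B` had already received that many messages.
--
-- `Evolved` is available only for a refob that has been issued and is no longer carried. The inner
-- refobs of a chain qualify: a `CreatedUsing` fact keeps its first refob activated, and an
-- undelivered message keeps the refob it counts on activated or in release.
--
-- External actors stay outside the bookkeeping. A refob delivered to one leaves all counts, hence
-- the second case of `Live`; a mailbox of one is emptied without receive counts, hence the count
-- equations ask for an internal target.

open import Defs
open import Data.Nat using (ℕ; zero; suc; _+_; _∸_; _≤_; _<_; z≤n; s≤s; s≤s⁻¹; _≡ᵇ_; _≟_)
open import Data.Nat.Properties hiding (_≟_)
open import Data.Bool using (Bool; true; false; _∧_; not; T)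
open import Data.Bool.Properties using (T-∧; T?)
open import Data.Empty using (⊥; ⊥-elim)
open import Data.List using (List; []; _∷_; _++_; map; filterᵇ)
open import Data.List.Membership.Propositional using (_∈_; _∉_)
open import Data.List.Membership.Propositional.Properties using (∈-++⁺ˡ; ∈-++⁺ʳ; ∈-++⁻; ∈-map⁺; ∈-map⁻; ∈-filter⁺; ∈-filter⁻; ∈-insert)
open import Data.List.Properties using (map-∘)
open import Data.List.Relation.Unary.All as All using (All)
open import Data.List.Relation.Unary.AllPairs using (_∷_)
open import Data.List.Relation.Unary.Any using (here; there)
open import Data.List.Relation.Unary.Unique.Propositional using (Unique)
open import Data.Maybe using (Maybe; just; nothing; is-just)
open import Data.Maybe.Properties using (just-injective)
open import Data.Product using (∃-syntax; _×_; _,_; proj₁; proj₂)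
open import Data.Sum using (_⊎_; inj₁; inj₂; [_,_]′)
open import Data.Unit using (tt)
open import Function using (_∘_; id; case_of_)
open import Function.Bundles using (Equivalence)
open import Relation.Binary.Construct.Closure.ReflexiveTransitive using (ε; _◅_)
open import Relation.Binary.PropositionalEquality using (_≡_; _≢_; refl; sym; trans; cong; cong₂; subst)
open import Relation.Nullary using (¬_; Dec; yes; no)
open import Relation.Nullary.Decidable using (map′)

-- Knowledge sets

private
  ∧⁻ : ∀ {a b} → T (a ∧ b) → T a × T b
  ∧⁻ = Equivalence.to T-∧

  ∧⁺ : ∀ {a b} → T a → T b → T (a ∧ b)
  ∧⁺ p q = Equivalence.from T-∧ (p , q)

==ʳ⇒≡ : ∀ x y → T (x ==ʳ y) → x ≡ y
==ʳ⇒≡ (x ∶ a ⇒ b) (y ∶ c ⇒ d) p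
  with p₁ , q ← ∧⁻ {x ≡ᵇ y} p
  with p₂ , p₃ ← ∧⁻ {a ≡ᵇ c} q
  with refl ← ≡ᵇ⇒≡ x y p₁ | refl ← ≡ᵇ⇒≡ a c p₂ | refl ← ≡ᵇ⇒≡ b d p₃ = refl

==ʳ-refl : ∀ x → T (x ==ʳ x)
==ʳ-refl (x ∶ a ⇒ b) = ∧⁺ (≡⇒≡ᵇ x x refl) (∧⁺ (≡⇒≡ᵇ a a refl) (≡⇒≡ᵇ b b refl))

_≟ʳ_ : (x y : Refob) → Dec (x ≡ y)
x ≟ʳ y = map′ (==ʳ⇒≡ x y) (λ where refl → ==ʳ-refl x) (T? (x ==ʳ y))

==ᶠ⇒≡ : ∀ f g → T (f ==ᶠ g) → f ≡ g
==ᶠ⇒≡ (Created x) (Created y) p = cong Created (==ʳ⇒≡ x y p)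
==ᶠ⇒≡ (Released x) (Released y) p = cong Released (==ʳ⇒≡ x y p)
==ᶠ⇒≡ (CreatedUsing x z) (CreatedUsing y w) p with p₁ , p₂ ← ∧⁻ {x ==ʳ y} p =
  cong₂ CreatedUsing (==ʳ⇒≡ x y p₁) (==ʳ⇒≡ z w p₂)
==ᶠ⇒≡ (Activated x) (Activated y) p = cong Activated (==ʳ⇒≡ x y p)
==ᶠ⇒≡ (Unreleased x) (Unreleased y) p = cong Unreleased (==ʳ⇒≡ x y p)
==ᶠ⇒≡ (SentCount x n) (SentCount y m) p with p₁ , p₂ ← ∧⁻ {x ==ʳ y} p =
  cong₂ SentCount (==ʳ⇒≡ x y p₁) (≡ᵇ⇒≡ n m p₂)
==ᶠ⇒≡ (RecvCount x n) (RecvCount y m) p with p₁ , p₂ ← ∧⁻ {x ==ʳ y} p =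
  cong₂ RecvCount (==ʳ⇒≡ x y p₁) (≡ᵇ⇒≡ n m p₂)

==ᶠ-refl : ∀ f → T (f ==ᶠ f)
==ᶠ-refl (Created x) = ==ʳ-refl x
==ᶠ-refl (Released x) = ==ʳ-refl x
==ᶠ-refl (CreatedUsing x y) = ∧⁺ (==ʳ-refl x) (==ʳ-refl y)
==ᶠ-refl (Activated x) = ==ʳ-refl x
==ᶠ-refl (Unreleased x) = ==ʳ-refl x
==ᶠ-refl (SentCount x n) = ∧⁺ (==ʳ-refl x) (≡⇒≡ᵇ n n refl)
==ᶠ-refl (RecvCount x n) = ∧⁺ (==ʳ-refl x) (≡⇒≡ᵇ n n refl)

_≟ᶠ_ : (f g : Fact) → Dec (f ≡ g)
f ≟ᶠ g = map′ (==ᶠ⇒≡ f g) (λ where refl → ==ᶠ-refl f) (T? (f ==ᶠ g))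

open import Data.List.Membership.DecPropositional _≟ᶠ_ using () renaming (_∈?_ to _∈ᶠ?_)
open import Data.List.Membership.DecPropositional _≟ʳ_ using () renaming (_∈?_ to _∈ʳ?_)

T-not⁻ : ∀ {b} → T (not b) → ¬ T b
T-not⁻ {false} _ ()

T-not⁺ : ∀ {b} → ¬ T b → T (not b)
T-not⁺ {false} _ = tt
T-not⁺ {true} ¬p = ¬p tt

module _ (p : Fact → Bool) where

  ∈-discard⁻ : ∀ {f Φ} → f ∈ filterᵇ (not ∘ p) Φ → f ∈ Φ × ¬ T (p f)
  ∈-discard⁻ f∈ with f∈Φ , q ← ∈-filter⁻ (T? ∘ not ∘ p) f∈ = f∈Φ , T-not⁻ q

  ∈-discard⁺ : ∀ {f Φ} → f ∈ Φ → ¬ T (p f) → f ∈ filterᵇ (not ∘ p) Φ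
  ∈-discard⁺ f∈ ¬q = ∈-filter⁺ (T? ∘ not ∘ p) f∈ (T-not⁺ ¬q)

∈-remove⁻ : ∀ {f g Φ} → f ∈ remove g Φ → f ∈ Φ × f ≢ g
∈-remove⁻ {f} {g} f∈ with f∈Φ , ¬p ← ∈-discard⁻ (_==ᶠ g) f∈ = f∈Φ , λ where refl → ¬p (==ᶠ-refl f)

∈-remove⁺ : ∀ {f g Φ} → f ∈ Φ → f ∈ remove g Φ ⊎ f ≡ g
∈-remove⁺ {f} {g} f∈ with f ≟ᶠ g
... | yes f≡g = inj₂ f≡g
... | no f≢g = inj₁ (∈-discard⁺ (_==ᶠ g) f∈ (f≢g ∘ ==ᶠ⇒≡ f g))

isSentOf⁻ : ∀ {x} f → T (isSentOf x f) → ∃[ n ] f ≡ SentCount x n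
isSentOf⁻ {x} (SentCount y n) p with refl ← ==ʳ⇒≡ x y p = n , refl

isRecvOf⁻ : ∀ {x} f → T (isRecvOf x f) → ∃[ n ] f ≡ RecvCount x n
isRecvOf⁻ {x} (RecvCount y n) p with refl ← ==ʳ⇒≡ x y p = n , refl

∈-removeSent⁺ : ∀ {x f Φ} → f ∈ Φ → f ∈ removeSent x Φ ⊎ ∃[ n ] f ≡ SentCount x n
∈-removeSent⁺ {x} {f} f∈ with T? (isSentOf x f)
... | yes p = inj₂ (isSentOf⁻ f p)
... | no ¬p = inj₁ (∈-discard⁺ (isSentOf x) f∈ ¬p)

∈-removeRecv⁺ : ∀ {x f Φ} → f ∈ Φ → f ∈ removeRecv x Φ ⊎ ∃[ n ] f ≡ RecvCount x n
∈-removeRecv⁺ {x} {f} f∈ with T? (isRecvOf x f)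
... | yes p = inj₂ (isRecvOf⁻ f p)
... | no ¬p = inj₁ (∈-discard⁺ (isRecvOf x) f∈ ¬p)

∈-setSent⁻ : ∀ {x n f Φ} → f ∈ setSent x n Φ → f ∈ Φ ⊎ f ≡ SentCount x n
∈-setSent⁻ (here eq) = inj₂ eq
∈-setSent⁻ {x} (there f∈) = inj₁ (proj₁ (∈-discard⁻ (isSentOf x) f∈))

∈-setRecv⁻ : ∀ {x n f Φ} → f ∈ setRecv x n Φ → f ∈ Φ ⊎ f ≡ RecvCount x n
∈-setRecv⁻ (here eq) = inj₂ eq
∈-setRecv⁻ {x} (there f∈) = inj₁ (proj₁ (∈-discard⁻ (isRecvOf x) f∈))

∈-setSent⁺ : ∀ {x n f Φ} → f ∈ Φ → f ∈ setSent x n Φ ⊎ ∃[ k ] f ≡ SentCount x k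
∈-setSent⁺ = [ inj₁ ∘ there , inj₂ ]′ ∘ ∈-removeSent⁺

∈-setRecv⁺ : ∀ {x n f Φ} → f ∈ Φ → f ∈ setRecv x n Φ ⊎ ∃[ k ] f ≡ RecvCount x k
∈-setRecv⁺ = [ inj₁ ∘ there , inj₂ ]′ ∘ ∈-removeRecv⁺

setSent-unique : ∀ {x n k Φ} → SentCount x k ∈ setSent x n Φ → k ≡ n
setSent-unique (here refl) = refl
setSent-unique {x} {Φ = Φ} (there f∈) = ⊥-elim (proj₂ (∈-discard⁻ (isSentOf x) {Φ = Φ} f∈) (==ʳ-refl x))

setRecv-unique : ∀ {x n k Φ} → RecvCount x k ∈ setRecv x n Φ → k ≡ n
setRecv-unique (here refl) = refl
setRecv-unique {x} {Φ = Φ} (there f∈) = ⊥-elim (proj₂ (∈-discard⁻ (isRecvOf x) {Φ = Φ} f∈) (==ʳ-refl x))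

⊢-activated : ∀ {Φ x} → Φ ⊢ Activated x → Activated x ∈ Φ
⊢-activated (ax f∈) = f∈

-- The default count 0 rests on the absence of facts, so derivability is not monotone and inclusions
-- in both directions are needed.
⊢-sent-mono : ∀ {x n Φ Ψ} → (∀ k → SentCount x k ∈ Φ → SentCount x k ∈ Ψ) →
              (∀ k → SentCount x k ∈ Ψ → SentCount x k ∈ Φ) →
              Φ ⊢ SentCount x n → Ψ ⊢ SentCount x n
⊢-sent-mono f g (ax p) = ax (f _ p)
⊢-sent-mono f g (sent0 h) = sent0 (λ k p → h k (g k p))

⊢-recv-mono : ∀ {x n Φ Ψ} → (∀ k → RecvCount x k ∈ Φ → RecvCount x k ∈ Ψ) →
              (∀ k → RecvCount x k ∈ Ψ → RecvCount x k ∈ Φ) →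
              Φ ⊢ RecvCount x n → Ψ ⊢ RecvCount x n
⊢-recv-mono f g (ax p) = ax (f _ p)
⊢-recv-mono f g (recv0 h) = recv0 (λ k p → h k (g k p))

⊢-sent-unique : ∀ {x n k Φ} → (∀ {j} → SentCount x j ∈ Φ → j ≡ n) → SentCount x n ∈ Φ →
                Φ ⊢ SentCount x k → k ≡ n
⊢-sent-unique u n∈ (ax p) = u p
⊢-sent-unique u n∈ (sent0 h) = ⊥-elim (h _ n∈)

⊢-recv-unique : ∀ {x n k Φ} → (∀ {j} → RecvCount x j ∈ Φ → j ≡ n) → RecvCount x n ∈ Φ →
                Φ ⊢ RecvCount x k → k ≡ n
⊢-recv-unique u n∈ (ax p) = u p
⊢-recv-unique u n∈ (recv0 h) = ⊥-elim (h _ n∈)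

-- Counting

indicator : ∀ {P : Set} → Dec P → ℕ
indicator (yes _) = 1
indicator (no _) = 0

δ : Refob → Refob → ℕ
δ x y = indicator (x ≟ʳ y)

δ-refl : ∀ x → δ x x ≡ 1
δ-refl x with x ≟ʳ x
... | yes _ = refl
... | no x≢x = ⊥-elim (x≢x refl)

δ-≢ : ∀ {x y} → x ≢ y → δ x y ≡ 0
δ-≢ {x} {y} x≢y with x ≟ʳ y
... | yes x≡y = ⊥-elim (x≢y x≡y)
... | no _ = refl

module _ {X : Set} (w : X → ℕ) where

  tally : List X → ℕ
  tally [] = 0
  tally (a ∷ l) = w a + tally l

  tally-++ : ∀ l l′ → tally (l ++ l′) ≡ tally l + tally l′
  tally-++ [] l′ = refl
  tally-++ (a ∷ l) l′ rewrite tally-++ l l′ = sym (+-assoc (w a) _ _)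

  tally-insert : ∀ l a l′ → tally (l ++ a ∷ l′) ≡ w a + tally (l ++ l′)
  tally-insert [] a l′ = refl
  tally-insert (b ∷ l) a l′ rewrite tally-insert l a l′ | sym (+-assoc (w b) (w a) (tally (l ++ l′)))
    | +-comm (w b) (w a) = +-assoc (w a) _ _

  ∈⇒≤tally : ∀ {a l} → a ∈ l → w a ≤ tally l
  ∈⇒≤tally (here refl) = m≤m+n _ _
  ∈⇒≤tally (there a∈) = ≤-trans (∈⇒≤tally a∈) (m≤n+m _ _)

tally-∉ : ∀ {x l} → x ∉ l → tally (δ x) l ≡ 0
tally-∉ {l = []} x∉ = refl
tally-∉ {l = a ∷ l} x∉ rewrite δ-≢ (x∉ ∘ here) = tally-∉ (x∉ ∘ there)

∈⇒1≤tally : ∀ {x l} → x ∈ l → 1 ≤ tally (δ x) l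
∈⇒1≤tally {x} x∈ = ≤-trans (≤-reflexive (sym (δ-refl x))) (∈⇒≤tally (δ x) x∈)

tally-unique : ∀ {x l} → Unique (map token l) → tally (δ x) l ≤ 1
tally-unique {l = []} u = z≤n
tally-unique {x} {a ∷ l} (a∉ ∷ u) with x ≟ʳ a
... | no _ = tally-unique u
... | yes refl rewrite tally-∉ {x} {l} (λ x∈ → All.lookup a∉ (∈-map⁺ token x∈) refl) = ≤-refl

-- A knowledge list stands for a set, so multiplicities are ignored; mailboxes are
-- multisets and are counted by tally.
has : Fact → Knowledge → ℕ
has f Φ = indicator (f ∈ᶠ? Φ)

has≤1 : ∀ f Φ → has f Φ ≤ 1
has≤1 f Φ with f ∈ᶠ? Φ
... | yes _ = ≤-refl
... | no _ = z≤n

∈⇒has : ∀ {f Φ} → f ∈ Φ → 1 ≤ has f Φ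
∈⇒has {f} {Φ} f∈ with f ∈ᶠ? Φ
... | yes _ = ≤-refl
... | no f∉ = ⊥-elim (f∉ f∈)

has⇒∈ : ∀ {f Φ} → 1 ≤ has f Φ → f ∈ Φ
has⇒∈ {f} {Φ} p with f ∈ᶠ? Φ | p
... | yes f∈ | _ = f∈
... | no _ | ()

∉⇒has : ∀ {f Φ} → f ∉ Φ → has f Φ ≡ 0
∉⇒has {f} {Φ} f∉ with f ∈ᶠ? Φ
... | yes f∈ = ⊥-elim (f∉ f∈)
... | no _ = refl

-- The slack `k` pays for a fact that the step itself may add: 0 if it adds none, 1 for a release,
-- the number of carried copies when a message is received.
has-mono : ∀ {f Φ Ψ} k → (f ∈ Φ → f ∈ Ψ ⊎ 1 ≤ k) → has f Φ ≤ k + has f Ψ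
has-mono {f} {Φ} {Ψ} k h with f ∈ᶠ? Φ
... | no _ = z≤n
... | yes f∈ with h f∈
... | inj₁ g = ≤-trans (∈⇒has g) (m≤n+m _ k)
... | inj₂ g = ≤-trans g (m≤m+n k _)

upd-same : ∀ {X : Set} (f : Actor → X) a v → upd f a v a ≡ v
upd-same f a v with a ≡ᵇ a | ≡⇒≡ᵇ a a refl
... | true | _ = refl

upd-other : ∀ {X : Set} (f : Actor → X) {a} v {b} → b ≢ a → upd f a v b ≡ f b
upd-other f {a} v {b} b≢a with b ≡ᵇ a | ≡ᵇ⇒≡ b a
... | false | _ = refl
... | true | h = ⊥-elim (b≢a (h tt))

-- The life cycle of a refob

knowOf : Maybe ActorState → Knowledge
knowOf nothing = []
knowOf (just (busy Φ)) = Φ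
knowOf (just (idle Φ)) = Φ

know : Config → Actor → Knowledge
know κ a = knowOf (α κ a)

carriedBy : Refob → Msg → ℕ
carriedBy x (app _ R) = tally (δ x) R
carriedBy x (info _ _ _) = 0
carriedBy x (release _ _) = 0

releases : Refob → Msg → ℕ
releases x (app _ _) = 0
releases x (info _ _ _) = 0
releases x (release y _) = δ x y

countedOn : Refob → Msg → ℕ
countedOn x (app (just y) _) = δ x y
countedOn x (app nothing _) = 0
countedOn x (info y _ _) = δ x y
countedOn x (release _ _) = 0

module _ (κ : Config) (x : Refob) where

  act car rel dead msgs : ℕ
  act  = has (Activated x) (know κ (owner x))
  car  = tally (carriedBy x) (μ κ (owner x))
  rel  = tally (releases x) (μ κ (target x))
  dead = has (Released x) (know κ (target x))
  msgs = tally (countedOn x) (μ κ (target x))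

  Sent Recv Releasing : ℕ → Set
  Sent n      = know κ (owner x) ⊢ SentCount x n
  Recv n      = know κ (target x) ⊢ RecvCount x n
  Releasing n = release x n ∈ μ κ (target x)

  Internal : Set
  Internal = target x ∉ χ κ

  -- The four summands of `uniq` are the stages of one life, so at most one of them is occupied.
  -- `carrier` turns traffic counted on `x` into evidence that `x` is alive. `unborn` provides the
  -- starting point of the count equation: when a carried refob becomes activated, no count from an
  -- earlier use may be lying around.
  record RefobInv : Set where
    field
      uniq     : act + car + rel + dead ≤ 1
      carrier  : Internal → 1 ≤ msgs → 1 ≤ act + rel
      actCount : Internal → 1 ≤ act → ∀ {n m} → Sent n → Recv m → n ≡ m + msgs
      relCount : Internal → ∀ {n m} → Releasing n → Recv m → n ≡ m + msgs
      unborn   : token x ∉ usedTok κ ⊎ 1 ≤ car →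
                 (∀ {n} → Sent n → n ≡ 0) × (∀ {m} → Recv m → m ≡ 0)
      fresh    : token x ∉ usedTok κ → act + car + rel + dead ≡ 0

  Alive : Set
  Alive = 1 ≤ act + car + rel

-- What one step can do to one refob

data Origin (κ κ' : Config) (x : Refob) : Set where
  external     : target x ∈ χ κ → Origin κ κ' x
  receptionist : target x ∈ ρ κ → Origin κ κ' x
  created      : Created x ∈ know κ' (target x) → Origin κ κ' x
  -- The chain of `y` is known to exist before the step, while the creation record exists only after
  -- it; hence the two configurations.
  introduced   : ∀ {y} → Activated y ∈ know κ (owner y) → target y ≡ target x →
              CreatedUsing y x ∈ know κ' (owner y) → Origin κ κ' x

module _ (κ κ' : Config) (x : Refob) where

  -- The inequality total covers a carried refob that becomes activated, and one that is
  -- lost in a message delivered to an external actor.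
  record SenderQuiet : Set where
    constructor senderQuiet
    field
      total : act κ' x + car κ' x ≤ act κ x + car κ x
      carry : car κ' x ≤ car κ x
      kept  : act κ x ≤ act κ' x
      sent  : ∀ {n} → Sent κ' x n → Sent κ x n
      used  : ∀ {z} → CreatedUsing x z ∈ know κ (owner x) → CreatedUsing x z ∈ know κ' (owner x)

  record ReceiverQuiet : Set where
    constructor receiverQuiet
    field
      died : dead κ' x ≤ dead κ x
      recv : ∀ {n} → Recv κ' x n → Recv κ x n
      made : Created x ∈ know κ (target x) → Created x ∈ know κ' (target x)

  record MailQuiet : Set where
    constructor mailQuiet
    field
      rel≡   : rel κ' x ≡ rel κ x
      msgs≡  : msgs κ' x ≡ msgs κ x
      rels   : ∀ {n} → Releasing κ' x n → Releasing κ x n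
      infos  : ∀ {z b} → info x z b ∈ μ κ (target x) → info x z b ∈ μ κ' (target x)

  -- Cases follow the effect on `x` and not the rule: `sendMsg` serves Send and SendInfo, `recvMsg`
  -- serves Receive and Info, and one step is in general a different event for different refobs.
  data Event : Set where
    quiet : SenderQuiet → ReceiverQuiet → MailQuiet → Event
    create : token x ∉ usedTok κ → token x ∈ usedTok κ' →
      act κ' x + car κ' x ≤ 1 → (∀ {n} → Sent κ' x n → Sent κ x n) →
      ReceiverQuiet → MailQuiet → Origin κ κ' x → Event
    sendMsg : 1 ≤ act κ x → act κ x ≤ act κ' x →
      act κ' x + car κ' x ≤ act κ x + car κ x → car κ' x ≤ car κ x →
      (∀ {n'} → Sent κ' x n' → ∃[ n ] n' ≡ suc n × Sent κ x n) →
      (∀ {z} → CreatedUsing x z ∈ know κ (owner x) →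
         CreatedUsing x z ∈ know κ' (owner x) ⊎ ∃[ b ] info x z b ∈ μ κ' (target x)) →
      ReceiverQuiet →
      rel κ' x ≡ rel κ x → msgs κ' x ≡ suc (msgs κ x) →
      (∀ {n} → Releasing κ' x n → Releasing κ x n) →
      (∀ {z b} → info x z b ∈ μ κ (target x) → info x z b ∈ μ κ' (target x)) → Event
    recvMsg : Internal κ x → SenderQuiet →
      dead κ' x ≤ dead κ x → (∀ {n'} → Recv κ' x n' → ∃[ n ] n' ≡ suc n × Recv κ x n) →
      (Created x ∈ know κ (target x) → Created x ∈ know κ' (target x)) →
      rel κ' x ≡ rel κ x → msgs κ x ≡ suc (msgs κ' x) →
      (∀ {n} → Releasing κ' x n → Releasing κ x n) →
      (∀ {z b} → info x z b ∈ μ κ (target x) →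
         info x z b ∈ μ κ' (target x) ⊎ Created z ∈ know κ' (target x)) → Event
    sendRel : 1 ≤ act κ x → act κ' x ≡ 0 → car κ' x ≤ car κ x →
      (∀ {z} → CreatedUsing x z ∉ know κ (owner x)) →
      ReceiverQuiet →
      rel κ' x ≡ suc (rel κ x) → msgs κ' x ≡ msgs κ x →
      (∀ {n} → Releasing κ' x n → Releasing κ x n ⊎ Sent κ x n) →
      (∀ {z b} → info x z b ∈ μ κ (target x) → info x z b ∈ μ κ' (target x)) → Event
    recvRel : ∀ {n} → Internal κ x → SenderQuiet →
      Releasing κ x n → Recv κ x n →
      dead κ' x ≤ suc (dead κ x) → (∀ {n} → Recv κ' x n → Recv κ x n) →
      (Created x ∈ know κ (target x) → Created x ∈ know κ' (target x)) →
      rel κ x ≡ suc (rel κ' x) → msgs κ' x ≡ msgs κ x →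
      (∀ {n} → Releasing κ' x n → Releasing κ x n) →
      (∀ {z b} → info x z b ∈ μ κ (target x) → info x z b ∈ μ κ' (target x)) → Event
    -- Compaction may erase `Created x` and the receive count, so the receiver side is not quiet;
    -- that `x` is already released makes the loss harmless.
    compact : 1 ≤ dead κ x → dead κ' x ≤ dead κ x → SenderQuiet → MailQuiet → Event
    drop : target x ∈ χ κ → SenderQuiet → ReceiverQuiet → rel κ' x ≤ rel κ x → Event

-- Events preserve the invariant of a refob

data Stage : ℕ → ℕ → ℕ → ℕ → Set where
  none      : Stage 0 0 0 0
  activated : Stage 1 0 0 0
  carried   : Stage 0 1 0 0
  releasing : Stage 0 0 1 0
  released  : Stage 0 0 0 1

stage : ∀ a c r d → a + c + r + d ≤ 1 → Stage a c r d
stage 0 0 0 0 _ = none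
stage 1 0 0 0 _ = activated
stage 0 1 0 0 _ = carried
stage 0 0 1 0 _ = releasing
stage 0 0 0 1 _ = released
stage 0 0 0 (suc (suc d)) (s≤s ())
stage 0 0 1 (suc d) (s≤s ())
stage 0 0 (suc (suc r)) d (s≤s ())
stage 0 1 0 (suc d) (s≤s ())
stage 0 1 (suc r) d (s≤s ())
stage 0 (suc (suc c)) r d (s≤s ())
stage 1 0 0 (suc d) (s≤s ())
stage 1 0 (suc r) d (s≤s ())
stage 1 (suc c) r d (s≤s ())
stage (suc (suc a)) c r d (s≤s ())

record Exclusive (a c r d : ℕ) : Set where
  field
    a×c : 1 ≤ a → 1 ≤ c → ⊥
    a×r : 1 ≤ a → 1 ≤ r → ⊥
    a×d : 1 ≤ a → 1 ≤ d → ⊥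
    c×r : 1 ≤ c → 1 ≤ r → ⊥
    c×d : 1 ≤ c → 1 ≤ d → ⊥
    r×d : 1 ≤ r → 1 ≤ d → ⊥
    r≤1 : r ≤ 1

exclusive : ∀ a c r d → a + c + r + d ≤ 1 → Exclusive a c r d
exclusive a c r d p = go (stage a c r d p)
  where
  go : ∀ {a c r d} → Stage a c r d → Exclusive a c r d
  go none = record { a×c = λ () ; a×r = λ () ; a×d = λ () ; c×r = λ () ; c×d = λ () ; r×d = λ () ; r≤1 = z≤n }
  go activated = record { a×c = λ _ () ; a×r = λ _ () ; a×d = λ _ () ; c×r = λ () ; c×d = λ () ; r×d = λ () ; r≤1 = z≤n }
  go carried = record { a×c = λ () ; a×r = λ () ; a×d = λ () ; c×r = λ _ () ; c×d = λ _ () ; r×d = λ () ; r≤1 = z≤n }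
  go releasing = record { a×c = λ () ; a×r = λ () ; a×d = λ () ; c×r = λ () ; c×d = λ () ; r×d = λ _ () ; r≤1 = ≤-refl }
  go released = record { a×c = λ () ; a×r = λ () ; a×d = λ () ; c×r = λ () ; c×d = λ () ; r×d = λ () ; r≤1 = z≤n }

+-positive : ∀ a {b} → 1 ≤ a + b → 1 ≤ a ⊎ 1 ≤ b
+-positive zero p = inj₂ p
+-positive (suc a) _ = inj₁ (s≤s z≤n)

not-positive : ∀ {n} → ¬ 1 ≤ n → n ≡ 0
not-positive {zero} _ = refl
not-positive {suc n} ¬p = ⊥-elim (¬p (s≤s z≤n))

zero-sum : ∀ a c r {d} → a + c + r + d ≡ 0 → a ≡ 0 × c ≡ 0 × r ≡ 0 × d ≡ 0
zero-sum zero zero zero eq = refl , refl , refl , eq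

releasing⇒rel : ∀ κ x {n} → Releasing κ x n → 1 ≤ rel κ x
releasing⇒rel κ x p = ≤-trans (≤-reflexive (sym (δ-refl x))) (∈⇒≤tally (releases x) p)

module Preservation {κ κ' : Config} {x : Refob} (χ≡ : χ κ' ≡ χ κ)
  (used⊆ : ∀ {t} → t ∈ usedTok κ → t ∈ usedTok κ') (inv : RefobInv κ x) where

  open RefobInv inv
  open Exclusive (exclusive (act κ x) (car κ x) (rel κ x) (dead κ x) uniq)

  msgs⇒¬car : Internal κ x → 1 ≤ msgs κ x → ¬ 1 ≤ car κ x
  msgs⇒¬car i 1≤m 1≤c =
    [ (λ p → a×c p 1≤c) , c×r 1≤c ]′ (+-positive (act κ x) (carrier i 1≤m))

  fresh⇒ : token x ∉ usedTok κ → act κ x ≡ 0 × car κ x ≡ 0 × rel κ x ≡ 0 × dead κ x ≡ 0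
  fresh⇒ f = zero-sum (act κ x) (car κ x) (rel κ x) (fresh f)

  unused : token x ∉ usedTok κ' → token x ∉ usedTok κ
  unused f = f ∘ used⊆

  private
    internal : Internal κ' x → Internal κ x
    internal = subst (target x ∉_) χ≡

    0≱1 : ∀ {n} {A : Set} → n ≡ 0 → 1 ≤ n → A
    0≱1 refl ()

    msgs-fresh : Internal κ x → token x ∉ usedTok κ → msgs κ x ≡ 0
    msgs-fresh i f = not-positive λ p → [ 0≱1 (proj₁ (fresh⇒ f)) , 0≱1 (proj₁ (proj₂ (proj₂ (fresh⇒ f)))) ]′
      (+-positive (act κ x) (carrier i p))

    sum-mono : ∀ {r r' d d'} → act κ' x + car κ' x ≤ act κ x + car κ x → r' ≤ r → d' ≤ d →
      act κ' x + car κ' x + r' + d' ≤ act κ x + car κ x + r + d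
    sum-mono t r d = +-mono-≤ (+-mono-≤ t r) d

    act⊎car : act κ' x + car κ' x ≤ act κ x + car κ x → 1 ≤ act κ' x → 1 ≤ act κ x ⊎ 1 ≤ car κ x
    act⊎car t p = +-positive (act κ x) (≤-trans p (≤-trans (m≤m+n _ _) t))

    unborn' : (∀ {n} → Sent κ' x n → Sent κ x n) → (∀ {n} → Recv κ' x n → Recv κ x n) →
      token x ∉ usedTok κ ⊎ 1 ≤ car κ x →
      (∀ {n} → Sent κ' x n → n ≡ 0) × (∀ {m} → Recv κ' x m → m ≡ 0)
    unborn' s r u = (λ q → proj₁ (unborn u) (s q)) , (λ q → proj₂ (unborn u) (r q))

    earlier : car κ' x ≤ car κ x → token x ∉ usedTok κ' ⊎ 1 ≤ car κ' x → token x ∉ usedTok κ ⊎ 1 ≤ car κ x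
    earlier c (inj₁ f) = inj₁ (unused f)
    earlier c (inj₂ p) = inj₂ (≤-trans p c)

    sum-zero : act κ' x + car κ' x + rel κ' x + dead κ' x ≤ act κ x + car κ x + rel κ x + dead κ x →
      token x ∉ usedTok κ' → act κ' x + car κ' x + rel κ' x + dead κ' x ≡ 0
    sum-zero le f = n≤0⇒n≡0 (≤-trans le (≤-reflexive (fresh (unused f))))

  preserve : Event κ κ' x → RefobInv κ' x
  preserve (quiet s r m) = record
    { uniq = ≤-trans sum≤ uniq
    ; carrier = λ i p → ≤-trans (carrier (internal i) (subst (1 ≤_) msgs≡ p)) (+-mono-≤ kept (≤-reflexive (sym rel≡)))
    -- Either `x` was activated before, or it was carried. In the second case both counts are 0 by
    -- `unborn`, and nothing is in transit on a refob that is neither activated nor in release.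
    ; actCount = λ i p sn rm → [ (λ a → trans (actCount (internal i) a (sent sn) (recv rm)) (cong (_ +_) (sym msgs≡)))
        , (λ c → case (proj₁ (unborn (inj₂ c)) (sent sn) , proj₂ (unborn (inj₂ c)) (recv rm)) of λ where
             (refl , refl) → sym (trans msgs≡ (not-positive λ q → msgs⇒¬car (internal i) q c))) ]′ (act⊎car total p)
    ; relCount = λ i p rm → trans (relCount (internal i) (rels p) (recv rm)) (cong (_ +_) (sym msgs≡))
    ; unborn = λ u → unborn' sent recv (earlier carry u)
    ; fresh = sum-zero sum≤
    }
    where
    open SenderQuiet s
    open ReceiverQuiet r
    open MailQuiet m
    sum≤ = sum-mono total (≤-reflexive rel≡) died
  preserve (create f t le sent r m _) = record
    { uniq = ≤-trans (+-mono-≤ (+-mono-≤ le (≤-reflexive r0)) (≤-reflexive d0)) ≤-refl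
    ; carrier = λ i p → 0≱1 (trans msgs≡ (msgs-fresh (internal i) f)) p
    ; actCount = λ i _ sn rm → case (proj₁ (unborn (inj₁ f)) (sent sn) , proj₂ (unborn (inj₁ f)) (recv rm)) of λ where
             (refl , refl) → sym (trans msgs≡ (msgs-fresh (internal i) f))
    ; relCount = λ i p _ → 0≱1 r0 (releasing⇒rel κ' x p)
    ; unborn = λ _ → unborn' sent recv (inj₁ f)
    ; fresh = λ f' → ⊥-elim (f' t)
    }
    where
    open ReceiverQuiet r
    open MailQuiet m
    r0 = trans rel≡ (proj₁ (proj₂ (proj₂ (fresh⇒ f))))
    d0 = n≤0⇒n≡0 (≤-trans died (≤-reflexive (proj₂ (proj₂ (proj₂ (fresh⇒ f))))))
  preserve (sendMsg a≥1 kept total carry sent _ r rel≡ msgs≡ rels _) = record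
    { uniq = ≤-trans sum≤ uniq
    ; carrier = λ i p → ≤-trans (≤-trans a≥1 kept) (m≤m+n _ _)
    ; actCount = λ i p sn rm → case sent sn of λ where
        (n , refl , sn') → trans (cong suc (actCount (internal i) a≥1 sn' (recv rm)))
          (trans (sym (+-suc _ _)) (cong (_ +_) (sym msgs≡)))
    ; relCount = λ i p _ → ⊥-elim (a×r a≥1 (releasing⇒rel κ x (rels p)))
    ; unborn = λ u → ⊥-elim (born (earlier carry u))
    ; fresh = sum-zero sum≤
    }
    where
    open ReceiverQuiet r
    sum≤ = sum-mono total (≤-reflexive rel≡) died
    born : token x ∉ usedTok κ ⊎ 1 ≤ car κ x → ⊥
    born (inj₁ f) = 0≱1 (proj₁ (fresh⇒ f)) a≥1
    born (inj₂ c) = a×c a≥1 c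
  preserve (recvMsg int s died recv _ rel≡ msgs≡ rels _) = record
    { uniq = ≤-trans sum≤ uniq
    ; carrier = λ i p → ≤-trans (carrier int m≥1) (+-mono-≤ kept (≤-reflexive (sym rel≡)))
    ; actCount = λ i p sn rm → case recv rm of λ where
        (n , refl , rm') → [ (λ a → fix (actCount int a (sent sn) rm')) , (λ c → ⊥-elim (msgs⇒¬car int m≥1 c)) ]′ (act⊎car total p)
    ; relCount = λ i p rm → case recv rm of λ where
        (n , refl , rm') → fix (relCount int (rels p) rm')
    ; unborn = λ u → ⊥-elim (born (earlier carry u))
    ; fresh = sum-zero sum≤
    }
    where
    open SenderQuiet s
    m≥1 : 1 ≤ msgs κ x
    m≥1 = subst (1 ≤_) (sym msgs≡) (s≤s z≤n)
    sum≤ = sum-mono total (≤-reflexive rel≡) died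
    fix : ∀ {k n} → k ≡ n + msgs κ x → k ≡ suc n + msgs κ' x
    fix eq = trans eq (trans (cong (_ +_) msgs≡) (+-suc _ _))
    born : token x ∉ usedTok κ ⊎ 1 ≤ car κ x → ⊥
    born (inj₁ f) = 0≱1 (msgs-fresh int f) m≥1
    born (inj₂ c) = msgs⇒¬car int m≥1 c
  preserve (sendRel a≥1 a'0 carry _ r rel≡ msgs≡ rels _) = record
    { uniq = ≤-trans (+-mono-≤ (≤-trans (≤-reflexive shift) (+-monoˡ-≤ (rel κ x) lost)) died) uniq
    ; carrier = λ i p → ≤-trans (subst (1 ≤_) (sym rel≡) (s≤s z≤n)) (m≤n+m _ (act κ' x))
    ; actCount = λ i p → 0≱1 a'0 p
    -- The new release message quotes the current send count, so its equation is `actCount` at the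
    -- moment of sending.
    ; relCount = λ i p rm → [ (λ q → ⊥-elim (a×r a≥1 (releasing⇒rel κ x q)))
        , (λ sn → trans (actCount (internal i) a≥1 sn (recv rm)) (cong (_ +_) (sym msgs≡))) ]′ (rels p)
    ; unborn = λ u → ⊥-elim (born (earlier carry u))
    ; fresh = λ f → 0≱1 (proj₁ (fresh⇒ (unused f))) a≥1
    }
    where
    open ReceiverQuiet r
    -- Giving up `Activated x` pays for the release message in the sum of stages.
    lost : suc (act κ' x + car κ' x) ≤ act κ x + car κ x
    lost = ≤-trans (≤-reflexive (cong (λ a → suc (a + car κ' x)) a'0)) (+-mono-≤ a≥1 carry)
    shift : act κ' x + car κ' x + rel κ' x ≡ suc (act κ' x + car κ' x) + rel κ x
    shift = trans (cong (act κ' x + car κ' x +_) rel≡) (+-suc _ _)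
    born : token x ∉ usedTok κ ⊎ 1 ≤ car κ x → ⊥
    born (inj₁ f) = 0≱1 (proj₁ (fresh⇒ f)) a≥1
    born (inj₂ c) = a×c a≥1 c
  preserve (recvRel int s rn rcv died recv _ rel≡ msgs≡ rels _) = record
    { uniq = ≤-trans (≤-trans (+-mono-≤ (+-monoˡ-≤ (rel κ' x) total) died) (≤-reflexive shift)) uniq
    ; carrier = λ i p → 0≱1 (trans msgs≡ msgs0) p
    ; actCount = λ i p → ⊥-elim ([ (λ a → a×r a r≥1) , (λ c → c×r c r≥1) ]′ (act⊎car total p))
    ; relCount = λ i p → 0≱1 r'0 (releasing⇒rel κ' x p)
    ; unborn = λ u → unborn' sent recv (earlier carry u)
    ; fresh = λ f → 0≱1 (proj₁ (proj₂ (proj₂ (fresh⇒ (unused f))))) r≥1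
    }
    where
    open SenderQuiet s
    r≥1 = releasing⇒rel κ x rn
    -- The rule fires only when the quoted count equals the receive count `n`, so `relCount` reads
    -- `n ≡ n + msgs κ x`: a release never overtakes the messages it accounts for.
    msgs0 : msgs κ x ≡ 0
    msgs0 = sym (+-cancelˡ-≡ _ 0 (msgs κ x) (trans (+-identityʳ _) (relCount int rn rcv)))
    r'0 : rel κ' x ≡ 0
    r'0 = n≤0⇒n≡0 (s≤s⁻¹ (subst (_≤ 1) rel≡ r≤1))
    shift : act κ x + car κ x + rel κ' x + suc (dead κ x) ≡ act κ x + car κ x + rel κ x + dead κ x
    shift = trans (+-suc _ _) (cong (_+ dead κ x) (trans (sym (+-suc _ _)) (cong (act κ x + car κ x +_) (sym rel≡))))
  preserve (compact d≥1 died s m) = record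
    { uniq = ≤-trans sum≤ uniq
    ; carrier = λ i p → ≤-trans (carrier (internal i) (subst (1 ≤_) msgs≡ p)) (+-mono-≤ kept (≤-reflexive (sym rel≡)))
    ; actCount = λ i p → ⊥-elim ([ (λ a → a×d a d≥1) , (λ c → c×d c d≥1) ]′ (act⊎car total p))
    ; relCount = λ i p → ⊥-elim (r×d (releasing⇒rel κ x (rels p)) d≥1)
    ; unborn = λ u → ⊥-elim (born (earlier carry u))
    ; fresh = sum-zero sum≤
    }
    where
    open SenderQuiet s
    open MailQuiet m
    sum≤ = sum-mono total (≤-reflexive rel≡) died
    born : token x ∉ usedTok κ ⊎ 1 ≤ car κ x → ⊥
    born (inj₁ f) = 0≱1 (proj₂ (proj₂ (proj₂ (fresh⇒ f)))) d≥1
    born (inj₂ c) = c×d c d≥1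
  preserve (drop e s r rel≤) = record
    { uniq = ≤-trans sum≤ uniq
    ; carrier = λ i → ⊥-elim (internal i e)
    ; actCount = λ i → ⊥-elim (internal i e)
    ; relCount = λ i → ⊥-elim (internal i e)
    ; unborn = λ u → unborn' sent recv (earlier carry u)
    ; fresh = sum-zero sum≤
    }
    where
    open SenderQuiet s
    open ReceiverQuiet r
    sum≤ = sum-mono total rel≤ died

-- Chains and the invariant of a configuration

-- All refobs of a chain share one target. The links store nothing about life cycles: if the target
-- is internal, every refob before the head is activated because a `CreatedUsing` fact names it, or
-- is activated or in release because an `info` message is counted on it. Only the head needs a
-- separate assumption, `Live`.
data Chain (κ : Config) : Refob → Set where
  root     : ∀ {x} → Created x ∈ know κ (target x) → Chain κ x
  recorded : ∀ {x y} → Chain κ y → target y ≡ target x →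
             CreatedUsing y x ∈ know κ (owner y) → Chain κ x
  notified : ∀ {x y b} → Chain κ y → target y ≡ target x →
             info y x b ∈ μ κ (target y) → Chain κ x

-- A refob held by an external actor is in none of the counted stages, since Out discards the
-- message that carried it, yet its target can still be reached through it.
Live : Config → Refob → Set
Live κ x = Alive κ x ⊎ owner x ∈ χ κ

-- The clause for `app nothing` stays true because receptionists are never removed. The one for
-- `release` says that only internal owners give up refobs; it is the source of `releasedAt`.
MsgInv : Config → Actor → Msg → Set
MsgInv κ a (app (just x) R) = target x ≡ a × All (λ z → owner z ≡ a) R
MsgInv κ a (app nothing R)  = a ∈ ρ κ × All (λ z → owner z ≡ a) R
MsgInv κ a (info y _ _)     = target y ≡ a
MsgInv κ a (release x _)    = target x ≡ a × owner x ∉ χ κ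

record ConfigInv (κ : Config) : Set where
  field
    refobs     : ∀ x → RefobInv κ x
    extern     : ∀ {a} → a ∈ χ κ → α κ a ≡ nothing
    externUsed : ∀ {a} → a ∈ χ κ → a ∈ usedAct κ
    unusedAct  : ∀ {a} → a ∉ usedAct κ → α κ a ≡ nothing
    mail       : ∀ {a m} → m ∈ μ κ a → MsgInv κ a m
    releasedAt : ∀ {a x} → Released x ∈ know κ a → target x ≡ a × owner x ∉ χ κ
    -- Send introduces a record only for an activated refob, and SendRelease waits until no such
    -- record is left.
    usingAct   : ∀ {x z} → CreatedUsing x z ∈ know κ (owner x) → Activated x ∈ know κ (owner x)
    chained    : ∀ {x} → Alive κ x → Internal κ x → Chain κ x ⊎ target x ∈ ρ κ
    reception  : ∀ {b} → b ∈ ρ κ → b ∉ χ κ × ∃[ x ] owner x ∈ χ κ × target x ≡ b × Chain κ x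

alive-act : ∀ κ x → 1 ≤ act κ x → Alive κ x
alive-act κ x p = ≤-trans p (≤-trans (m≤m+n _ _) (m≤m+n _ _))

alive-car : ∀ κ x → 1 ≤ car κ x → Alive κ x
alive-car κ x p = ≤-trans p (≤-trans (m≤n+m _ (act κ x)) (m≤m+n _ _))

alive-rel : ∀ κ x → 1 ≤ rel κ x → Alive κ x
alive-rel κ x p = ≤-trans p (m≤n+m _ (act κ x + car κ x))

msgs⇒alive : ∀ {κ x} → RefobInv κ x → Internal κ x → 1 ≤ msgs κ x → Alive κ x
msgs⇒alive {κ} {x} inv i p =
  [ alive-act κ x , alive-rel κ x ]′ (+-positive (act κ x) (RefobInv.carrier inv i p))

counted : ∀ κ x {m} → countedOn x m ≡ 1 → m ∈ μ κ (target x) → 1 ≤ msgs κ x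
counted κ x eq p = ≤-trans (≤-reflexive (sym eq)) (∈⇒≤tally (countedOn x) p)

-- What events leave intact: finished refobs and the knowledge of senders

Used : Config → Refob → Set
Used κ x = ¬ token x ∉ usedTok κ

-- Compaction can erase `Released x`, so that fact is no lasting mark of a release. What lasts is
-- that the token has been issued and that none of the other three stages is occupied.
Finished : Config → Refob → Set
Finished κ x = Used κ x × ¬ Alive κ x

positive⇒used : ∀ {κ x} → RefobInv κ x → 1 ≤ act κ x + car κ x + rel κ x + dead κ x → Used κ x
positive⇒used inv p f rewrite RefobInv.fresh inv f = n≮0 p

alive⇒used : ∀ {κ x} → RefobInv κ x → Alive κ x → Used κ x
alive⇒used inv p = positive⇒used inv (≤-trans p (m≤m+n _ _))

alive⇒¬dead : ∀ {κ x} → RefobInv κ x → Alive κ x → ¬ 1 ≤ dead κ x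
alive⇒¬dead {κ} {x} inv p d = n≮n 1 (≤-trans (+-mono-≤ p d) (RefobInv.uniq inv))

dead⇒finished : ∀ {κ x} → RefobInv κ x → Released x ∈ know κ (target x) → Finished κ x
dead⇒finished {κ} {x} inv r = positive⇒used inv (≤-trans (∈⇒has r) (m≤n+m _ (act κ x + car κ x + rel κ x)))
                            , λ p → alive⇒¬dead inv p (∈⇒has r)

-- Read backwards from the later knowledge Ψ, since it is in the owner's snapshot, which
-- may still lie ahead, that x is known to be activated.
Calm Grown Evolved : Refob → Knowledge → Knowledge → Set
Calm x Φ Ψ = (∀ {n} → Ψ ⊢ SentCount x n → Φ ⊢ SentCount x n) ×
             (∀ {z} → CreatedUsing x z ∈ Φ → CreatedUsing x z ∈ Ψ)
Grown x Φ Ψ = ∀ {n} → Ψ ⊢ SentCount x n → ∃[ m ] m < n × Φ ⊢ SentCount x m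
Evolved x Φ Ψ = Activated x ∈ Ψ → Activated x ∈ Φ × (Calm x Φ Ψ ⊎ Grown x Φ Ψ)

evolved-refl : ∀ {x Φ} → Evolved x Φ Φ
evolved-refl a = a , inj₁ (id , id)

evolved-trans : ∀ {x Φ Ψ Θ} → Evolved x Φ Ψ → Evolved x Ψ Θ → Evolved x Φ Θ
evolved-trans {x} {Φ} {Ψ} {Θ} e f c with b , q ← f c with a , p ← e b = a , go p q
  where
  go : Calm x Φ Ψ ⊎ Grown x Φ Ψ → Calm x Ψ Θ ⊎ Grown x Ψ Θ → Calm x Φ Θ ⊎ Grown x Φ Θ
  go (inj₁ (s , u)) (inj₁ (s' , u')) = inj₁ (s ∘ s' , u' ∘ u)
  go (inj₁ (s , _)) (inj₂ h) = inj₂ λ k → case h k of λ where (m , m<n , k') → m , m<n , s k'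
  go (inj₂ h) (inj₁ (s , _)) = inj₂ (h ∘ s)
  go (inj₂ h) (inj₂ h') = inj₂ λ k → case h' k of λ where
    (m , m<n , k') → case h k' of λ where (l , l<m , k″) → l , <-trans l<m m<n , k″

module _ {κ κ' : Config} {x : Refob} where

  car-step : Event κ κ' x → Used κ x → car κ x ≡ 0 → car κ' x ≡ 0
  car-step e u c0 = n≤0⇒n≡0 (≤-trans (carry e) (≤-reflexive c0))
    where
    carry : Event κ κ' x → car κ' x ≤ car κ x
    carry (quiet s _ _) = SenderQuiet.carry s
    carry (create f _ _ _ _ _ _) = ⊥-elim (u f)
    carry (sendMsg _ _ _ c _ _ _ _ _ _ _) = c
    carry (recvMsg _ s _ _ _ _ _ _ _) = SenderQuiet.carry s
    carry (sendRel _ _ c _ _ _ _ _ _) = c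
    carry (recvRel _ s _ _ _ _ _ _ _ _ _) = SenderQuiet.carry s
    carry (compact _ _ s _) = SenderQuiet.carry s
    carry (drop _ s _ _) = SenderQuiet.carry s

  -- Apart from creation, every event moves `x` only onward through its stages. Hence a finished
  -- refob never returns, and a chain has to be built from scratch for newly created refobs only.
  alive-back : Event κ κ' x → Alive κ' x → Alive κ x ⊎ token x ∉ usedTok κ × Origin κ κ' x
  alive-back (quiet s _ m) p =
    inj₁ (≤-trans p (+-mono-≤ (SenderQuiet.total s) (≤-reflexive (MailQuiet.rel≡ m))))
  alive-back (create f _ _ _ _ _ o) p = inj₂ (f , o)
  alive-back (sendMsg a≥1 _ _ _ _ _ _ _ _ _ _) p = inj₁ (alive-act κ x a≥1)
  alive-back (recvMsg _ s _ _ _ r _ _ _) p =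
    inj₁ (≤-trans p (+-mono-≤ (SenderQuiet.total s) (≤-reflexive r)))
  alive-back (sendRel a≥1 _ _ _ _ _ _ _ _) p = inj₁ (alive-act κ x a≥1)
  alive-back (recvRel _ _ r _ _ _ _ _ _ _ _) p = inj₁ (alive-rel κ x (releasing⇒rel κ x r))
  alive-back (compact _ _ s m) p =
    inj₁ (≤-trans p (+-mono-≤ (SenderQuiet.total s) (≤-reflexive (MailQuiet.rel≡ m))))
  alive-back (drop _ s _ r) p = inj₁ (≤-trans p (+-mono-≤ (SenderQuiet.total s) r))

  finished-step : (∀ {t} → t ∈ usedTok κ → t ∈ usedTok κ') →
                  Event κ κ' x → Finished κ x → Finished κ' x
  finished-step used⊆ e (u , ¬a) = (λ f → u (f ∘ used⊆)) ,
    λ p → [ ¬a , u ∘ proj₁ ]′ (alive-back e p)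

  -- An issued refob that is not carried cannot become activated by a delivery, so an activation
  -- seen after the step was there before. While it persists, only `sendMsg` alters the sender side,
  -- and it raises the count by one.
  evolve : Event κ κ' x → Used κ x → car κ x ≡ 0 →
           Evolved x (know κ (owner x)) (know κ' (owner x))
  evolve e u c0 a∈ = go e
    where
    Goal : Set
    Goal = Activated x ∈ know κ (owner x) ×
      (Calm x (know κ (owner x)) (know κ' (owner x)) ⊎ Grown x (know κ (owner x)) (know κ' (owner x)))
    same : SenderQuiet κ κ' x → Goal
    same s = has⇒∈ (≤-trans (≤-trans (∈⇒has a∈) (m≤m+n _ (car κ' x)))
                   (≤-trans total (≤-reflexive (trans (cong (act κ x +_) c0) (+-identityʳ _)))))
           , inj₁ (sent , used)
      where open SenderQuiet s
    go : Event κ κ' x → Goal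
    go (quiet s _ _) = same s
    go (create f _ _ _ _ _ _) = ⊥-elim (u f)
    go (sendMsg a≥1 _ _ _ s _ _ _ _ _ _) = has⇒∈ a≥1 , inj₂ λ q → case s q of λ where
      (n , refl , q') → n , ≤-refl , q'
    go (recvMsg _ s _ _ _ _ _ _ _) = same s
    go (sendRel _ a0 _ _ _ _ _ _ _) = ⊥-elim (n≮0 (≤-trans (∈⇒has a∈) (≤-reflexive a0)))
    go (recvRel _ s _ _ _ _ _ _ _ _ _) = same s
    go (compact _ _ s _) = same s
    go (drop _ s _ _) = same s

-- Chains survive a step

module ChainStep {κ κ' : Config} (inv : ConfigInv κ) (χ≡ : χ κ' ≡ χ κ)
  (ρ⊆ : ∀ {a} → a ∈ ρ κ → a ∈ ρ κ') (events : ∀ x → Event κ κ' x) where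

  open ConfigInv inv

  -- Only compaction deletes `Created x`, and only after a release. An alive refob is not released,
  -- by exclusiveness of the stages; one owned by an external actor never is, by `releasedAt`.
  created-step : ∀ {x} → Event κ κ' x → Live κ x → Internal κ x →
                 Created x ∈ know κ (target x) → Created x ∈ know κ' (target x)
  created-step (quiet _ r _) l i = ReceiverQuiet.made r
  created-step (create _ _ _ _ r _ _) l i = ReceiverQuiet.made r
  created-step (sendMsg _ _ _ _ _ _ r _ _ _ _) l i = ReceiverQuiet.made r
  created-step (recvMsg _ _ _ _ c _ _ _ _) l i = c
  created-step (sendRel _ _ _ _ r _ _ _ _) l i = ReceiverQuiet.made r
  created-step (recvRel _ _ _ _ _ _ c _ _ _ _) l i = c
  created-step {x} (compact d _ _ _) l i =
    ⊥-elim ([ (λ p → alive⇒¬dead (refobs x) p d) , proj₂ (releasedAt (has⇒∈ d)) ]′ l)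
  created-step (drop e _ _ _) l i = ⊥-elim (i e)

  chain-step : ∀ {x} → Chain κ x → Live κ x → Internal κ x → Chain κ' x
  chain-step {x} (root c) l i = root (created-step (events x) l i c)
  chain-step {x} (recorded {y = y} ch eq rec) l i = link (events y)
    where
    i' : Internal κ y
    i' = subst (_∉ χ κ) (sym eq) i
    y-act : 1 ≤ act κ y
    y-act = ∈⇒has (usingAct rec)
    ch' : Chain κ' y
    ch' = chain-step ch (inj₁ (alive-act κ y y-act)) i'
    via : SenderQuiet κ κ' y → Chain κ' x
    via s = recorded ch' eq (SenderQuiet.used s rec)
    link : Event κ κ' y → Chain κ' x
    link (quiet s _ _) = via s
    link (create f _ _ _ _ _ _) = ⊥-elim (alive⇒used (refobs y) (alive-act κ y y-act) f)
    link (sendMsg _ _ _ _ _ u _ _ _ _ _) = [ recorded ch' eq , notified ch' eq ∘ proj₂ ]′ (u rec)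
    link (recvMsg _ s _ _ _ _ _ _ _) = via s
    link (sendRel _ _ _ u _ _ _ _ _) = ⊥-elim (u rec)
    link (recvRel _ s _ _ _ _ _ _ _ _ _) = via s
    link (compact _ _ s _) = via s
    link (drop e _ _ _) = ⊥-elim (i' e)
  chain-step {x} (notified {y = y} {b} ch eq msg) l i = link (events y)
    where
    i' : Internal κ y
    i' = subst (_∉ χ κ) (sym eq) i
    ch' : Chain κ' y
    ch' = chain-step ch (inj₁ (msgs⇒alive (refobs y) i' (counted κ y {info y x b} (δ-refl y) msg))) i'
    link : Event κ κ' y → Chain κ' x
    link (quiet _ _ m) = notified ch' eq (MailQuiet.infos m msg)
    link (create _ _ _ _ _ m _) = notified ch' eq (MailQuiet.infos m msg)
    link (sendMsg _ _ _ _ _ _ _ _ _ _ m) = notified ch' eq (m msg)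
    link (recvMsg _ _ _ _ _ _ _ _ m) =
      [ notified ch' eq , root ∘ subst (λ a → Created x ∈ know κ' a) eq ]′ (m msg)
    link (sendRel _ _ _ _ _ _ _ _ m) = notified ch' eq (m msg)
    link (recvRel _ _ _ _ _ _ _ _ _ _ m) = notified ch' eq (m msg)
    link (compact _ _ _ m) = notified ch' eq (MailQuiet.infos m msg)
    link (drop e _ _ _) = ⊥-elim (i' e)

  chained-step : ∀ {x} → Alive κ' x → Internal κ' x → Chain κ' x ⊎ target x ∈ ρ κ'
  chained-step {x} a i' = [ old i , born ∘ proj₂ ]′ (alive-back (events x) a)
    where
    i : Internal κ x
    i = subst (target x ∉_) χ≡ i'
    old : ∀ {x} → Internal κ x → Alive κ x → Chain κ' x ⊎ target x ∈ ρ κ'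
    old i a = [ (λ ch → inj₁ (chain-step ch (inj₁ a) i)) , inj₂ ∘ ρ⊆ ]′ (chained a i)
    born : Origin κ κ' x → Chain κ' x ⊎ target x ∈ ρ κ'
    born (external e) = ⊥-elim (i e)
    born (receptionist r) = inj₂ (ρ⊆ r)
    born (created c) = inj₁ (root c)
    born (introduced {y} y∈ eq rec) =
      [ (λ ch → inj₁ (recorded ch eq rec)) , inj₂ ∘ subst (_∈ ρ κ') eq ]′
      (old {y} (subst (_∉ χ κ) (sym eq) i) (alive-act κ y (∈⇒has y∈)))

  reception-step : ∀ {b} → b ∈ ρ κ →
    b ∉ χ κ' × ∃[ x ] owner x ∈ χ κ' × target x ≡ b × Chain κ' x
  reception-step b∈ with b∉ , x , o , refl , ch ← reception b∈ =
    subst (_ ∉_) (sym χ≡) b∉ , x , subst (_ ∈_) (sym χ≡) o , refl , chain-step ch (inj₂ o) b∉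

-- Compaction and frozen actors

Forgotten : Refob → Fact → Set
Forgotten x f = f ≡ Created x ⊎ f ≡ Released x ⊎ ∃[ n ] f ≡ RecvCount x n

-- `Released x` is required of the older knowledge `Φ`. This makes the relation compose, and it ties
-- every forgotten fact to a refob that was released at the snapshot.
record Compacted (Φ Ψ : Knowledge) : Set where
  field
    shrinks : ∀ {f} → f ∈ Ψ → f ∈ Φ
    keeps   : ∀ {f} → f ∈ Φ → f ∈ Ψ ⊎ ∃[ x ] Released x ∈ Φ × Forgotten x f

compacted-refl : ∀ {Φ} → Compacted Φ Φ
compacted-refl = record { shrinks = id ; keeps = inj₁ }

compacted-trans : ∀ {Φ Ψ Θ} → Compacted Φ Ψ → Compacted Ψ Θ → Compacted Φ Θ
compacted-trans {Φ} {Ψ} {Θ} c d = record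
  { shrinks = C.shrinks ∘ D.shrinks
  ; keeps = λ f∈ → [ then ∘ D.keeps , inj₂ ]′ (C.keeps f∈)
  }
  where
  module C = Compacted c
  module D = Compacted d
  then : ∀ {f} → f ∈ Θ ⊎ ∃[ x ] Released x ∈ Ψ × Forgotten x f →
    f ∈ Θ ⊎ ∃[ x ] Released x ∈ Φ × Forgotten x f
  then (inj₁ f∈) = inj₁ f∈
  then (inj₂ (x , r , eq)) = inj₂ (x , C.shrinks r , eq)

-- Compaction erases only `Created`, `Released` and `RecvCount` facts. All sender facts agree in
-- both directions, so the older knowledge `Φ` may take the place of a later one.
compacted⇒evolved : ∀ {x Φ Ψ} → Compacted Φ Ψ → Evolved x Ψ Φ
compacted⇒evolved {x} {Φ} {Ψ} c a = act∈ (keeps a) , inj₁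
  (⊢-sent-mono (λ _ → sent∈ ∘ keeps) (λ _ → shrinks) , shrinks)
  where
  open Compacted c
  act∈ : Activated x ∈ Ψ ⊎ _ → Activated x ∈ Ψ
  act∈ (inj₁ p) = p
  act∈ (inj₂ (_ , _ , inj₁ ()))
  act∈ (inj₂ (_ , _ , inj₂ (inj₁ ())))
  act∈ (inj₂ (_ , _ , inj₂ (inj₂ ())))
  sent∈ : ∀ {n} → SentCount x n ∈ Ψ ⊎ _ → SentCount x n ∈ Ψ
  sent∈ (inj₁ p) = p
  sent∈ (inj₂ (_ , _ , inj₁ ()))
  sent∈ (inj₂ (_ , _ , inj₂ (inj₁ ())))
  sent∈ (inj₂ (_ , _ , inj₂ (inj₂ ())))

-- `finished` speaks of the releases in the snapshot `Φ`, since in the current knowledge the fact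
-- may have been compacted away.
record Frozen (κ : Config) (A : Actor) (Φ : Knowledge) : Set where
  field
    {current} : Knowledge
    isIdle    : α κ A ≡ just (idle current)
    compacted : Compacted Φ current
    finished  : ∀ {x} → Released x ∈ Φ → Finished κ x

record SnapshotInv (κ : Config) (A : Actor) (Φ : Knowledge) : Set where
  field
    notExtern  : A ∉ χ κ
    releasedAt : ∀ {x} → Released x ∈ Φ → target x ≡ A × owner x ∉ χ κ

-- A frozen actor of a finalized set has an empty mailbox

module Quiescence {κ : Config} (inv : ConfigInv κ) {Q : Snapshots} (fin : Finalized Q)
  (snaps : ∀ {A Φ} → Q A ≡ just Φ → SnapshotInv κ A Φ)
  -- A parameter, because its proof depends on the moment: before the final time the owner's
  -- snapshot may lie ahead and the execution is needed, afterwards compaction alone accounts for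
  -- the difference.
  (evolves : ∀ {x Φ} → Q (owner x) ≡ just Φ → Used κ x → car κ x ≡ 0 →
             Evolved x (know κ (owner x)) Φ)
  {B : Actor} {ΦB : Knowledge} (QB : Q B ≡ just ΦB) (frozen : Frozen κ B ΦB) where

  open ConfigInv inv
  open Frozen frozen

  private
    closed = proj₁ fin
    blocked = proj₂ (proj₂ fin B (ΦB , QB))

  knowB : know κ B ≡ current
  knowB = cong knowOf isIdle

  live⇒¬released : ∀ {x} → Live κ x → Released x ∉ ΦB
  live⇒¬released (inj₁ a) r = proj₂ (finished r) a
  live⇒¬released (inj₂ o) r = proj₂ (SnapshotInv.releasedAt (snaps QB) r) o

  -- Compaction forgets receive counts only of refobs released in `ΦB`, and a live refob is not
  -- among them.
  recv-current : ∀ {x n} → Live κ x → ΦB ⊢ RecvCount x n → know κ B ⊢ RecvCount x n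
  recv-current {x} l r rewrite knowB = ⊢-recv-mono (λ _ → still ∘ keeps) (λ _ → shrinks) r
    where
    open Compacted compacted
    still : ∀ {n} → RecvCount x n ∈ current ⊎ _ → RecvCount x n ∈ current
    still (inj₁ p) = p
    still (inj₂ (_ , _ , inj₁ ()))
    still (inj₂ (_ , _ , inj₂ (inj₁ ())))
    still (inj₂ (_ , r , inj₂ (inj₂ (_ , refl)))) = ⊥-elim (live⇒¬released l r)

  -- Blockedness provides one number `n`, sent according to the owner's snapshot and received
  -- according to `ΦB`. The latter is still the current receive count, so every current send count
  -- `m` satisfies `m ≡ n + msgs κ x`. In the calm case `n` itself is such a count, and nothing is
  -- in transit; in the grown case some `m < n` is one, which is impossible.
  settled : ∀ {x} → target x ≡ B → Live κ x → Used κ x → car κ x ≡ 0 → Q ⊢Q Unreleased x →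
    ∃[ Φ ] Q (owner x) ≡ just Φ × Activated x ∈ know κ (owner x) × msgs κ x ≡ 0 ×
           (∀ {z} → CreatedUsing x z ∈ know κ (owner x) → CreatedUsing x z ∈ Φ)
  settled {x} refl l u c0 un
    with Φ , QA , a ← closed x un (ΦB , QB)
       | Φ' , ΦB' , n , QA' , QB' , s , r ← blocked x refl un
    with refl ← just-injective (trans (sym QA) QA') | refl ← just-injective (trans (sym QB) QB')
    with a∈ , q ← evolves QA u c0 (⊢-activated a)
    = Φ , QA , a∈ , go q
    where
    i : Internal κ x
    i = SnapshotInv.notExtern (snaps QB)
    count : ∀ {m} → Sent κ x m → m ≡ n + msgs κ x
    count sm = RefobInv.actCount (refobs x) i (∈⇒has a∈) sm (recv-current l r)
    go : Calm x (know κ (owner x)) Φ ⊎ Grown x (know κ (owner x)) Φ → msgs κ x ≡ 0 × (∀ {z} → CreatedUsing x z ∈ know κ (owner x) → CreatedUsing x z ∈ Φ)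
    go (inj₁ (sent , used)) = sym (+-cancelˡ-≡ n 0 _ (trans (+-identityʳ n) (count (sent s)))) , used
    go (inj₂ less) with m , m<n , sm ← less s =
      ⊥-elim (n≮n n (≤-trans (s≤s (≤-trans (m≤m+n n _) (≤-reflexive (sym (count sm))))) m<n))

  act⇒¬car : ∀ {x} → 1 ≤ act κ x + rel κ x → car κ x ≡ 0
  act⇒¬car {x} p = not-positive λ c → [ (λ a → a×c a c) , c×r c ]′ (+-positive (act κ x) p)
    where open Exclusive (exclusive (act κ x) (car κ x) (rel κ x) (dead κ x) (RefobInv.uniq (refobs x)))

  -- Induction from the root, where `ΦB` itself knows of the creation. If the refob before a link is
  -- known to `Q`, then it is settled: its owner's snapshot contains the record of the link, and an
  -- `info` link cannot occur since nothing is in transit.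
  known : ∀ {x} → Chain κ x → target x ≡ B → Live κ x → Q ⊢Q Unreleased x
  known {x} (root c) refl l =
    B , ΦB , QB , unrel (ax (shrinks (subst (Created x ∈_) knowB c))) (live⇒¬released l)
    where open Compacted compacted
  known {x} (recorded {y = y} ch eq rec) refl l
    with a ← alive-act κ y (∈⇒has (usingAct rec))
    with Φ , QA , _ , _ , used ← settled eq (inj₁ a) (alive⇒used (refobs y) a)
           (act⇒¬car {y} (≤-trans (∈⇒has (usingAct rec)) (m≤m+n _ _))) (known ch eq (inj₁ a))
    = owner y , Φ , QA , unrel (cu (ax (used rec))) not-rel
    where
    -- `Released x` is found only at the target of `x`, so this snapshot would have to be `ΦB`.
    not-rel : Released x ∉ Φ
    not-rel r with refl ← proj₁ (SnapshotInv.releasedAt (snaps QA) r)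
      with refl ← just-injective (trans (sym QA) QB) = live⇒¬released l r
  known {x} (notified {y = y} {b} ch eq msg) refl l = ⊥-elim (n≮0 (subst (1 ≤_) (proj₁ (proj₂ (proj₂ (proj₂ s)))) m≥1))
    where
    m≥1 : 1 ≤ msgs κ y
    m≥1 = counted κ y {info y x b} (δ-refl y) msg
    i : Internal κ y
    i = subst (_∉ χ κ) (sym eq) (SnapshotInv.notExtern (snaps QB))
    a : Alive κ y
    a = msgs⇒alive (refobs y) i m≥1
    s = settled eq (inj₁ a) (alive⇒used (refobs y) a)
          (act⇒¬car {y} (RefobInv.carrier (refobs y) i m≥1)) (known ch eq (inj₁ a))

  -- A receptionist has a chain to a refob owned by an external actor. Closedness would put that
  -- owner in `Q`, but only internal actors take snapshots.
  not-receptionist : B ∉ ρ κ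
  not-receptionist B∈ with _ , x , o , refl , ch ← reception B∈
    with Φ , QE , _ ← closed x (known ch refl (inj₂ o)) (ΦB , QB)
    = SnapshotInv.notExtern (snaps QE) o

  -- Such a refob is alive and has a chain, hence is settled. This leaves no counted message, and it
  -- keeps `x` activated, which excludes a release in transit.
  no-traffic : ∀ {x} → target x ≡ B → 1 ≤ msgs κ x ⊎ 1 ≤ rel κ x → ⊥
  no-traffic {x} refl p with chained a i
    where
    i : Internal κ x
    i = SnapshotInv.notExtern (snaps QB)
    a : Alive κ x
    a = [ msgs⇒alive (refobs x) i , alive-rel κ x ]′ p
  ... | inj₂ B∈ = not-receptionist B∈
  ... | inj₁ ch = finish p
    where
    i : Internal κ x
    i = SnapshotInv.notExtern (snaps QB)
    ar : 1 ≤ act κ x + rel κ x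
    ar = [ RefobInv.carrier (refobs x) i , (λ r → ≤-trans r (m≤n+m _ (act κ x))) ]′ p
    a : Alive κ x
    a = [ msgs⇒alive (refobs x) i , alive-rel κ x ]′ p
    s = settled refl (inj₁ a) (alive⇒used (refobs x) a) (act⇒¬car {x} ar) (known ch refl (inj₁ a))
    open Exclusive (exclusive (act κ x) (car κ x) (rel κ x) (dead κ x) (RefobInv.uniq (refobs x)))
    finish : 1 ≤ msgs κ x ⊎ 1 ≤ rel κ x → ⊥
    finish (inj₁ m) = n≮0 (subst (1 ≤_) (proj₁ (proj₂ (proj₂ (proj₂ s)))) m)
    finish (inj₂ r) = a×r (∈⇒has (proj₁ (proj₂ (proj₂ s)))) r

  no-message : ∀ {m} → m ∉ μ κ B
  no-message {app (just x) R} m∈ with refl , _ ← mail m∈ =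
    no-traffic refl (inj₁ (counted κ x {app (just x) R} (δ-refl x) m∈))
  no-message {app nothing R} m∈ = not-receptionist (proj₁ (mail m∈))
  no-message {info y z b} m∈ with refl ← mail m∈ =
    no-traffic refl (inj₁ (counted κ y {info y z b} (δ-refl y) m∈))
  no-message {release x n} m∈ with refl , _ ← mail m∈ =
    no-traffic refl (inj₂ (releasing⇒rel κ x m∈))

  mailbox-empty : μ κ B ≡ []
  mailbox-empty with μ κ B | no-message
  ... | [] | _ = refl
  ... | m ∷ ms | h = ⊥-elim (h (here refl))

-- Every step acts on every refob by an event

-- The facts that a quiet step must not gain differ from those it must not lose. A sender may gain
-- `CreatedUsing` but not lose it; a receiver may gain `Created` and lose `Released`, but not
-- conversely.
data SenderCount (x : Refob) : Fact → Set where
  activated : SenderCount x (Activated x)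
  sent      : ∀ {n} → SenderCount x (SentCount x n)

data SenderFact (x : Refob) : Fact → Set where
  count : ∀ {f} → SenderCount x f → SenderFact x f
  creator : ∀ {z} → SenderFact x (CreatedUsing x z)

data ReceiverCount (x : Refob) : Fact → Set where
  released : ReceiverCount x (Released x)
  received : ∀ {n} → ReceiverCount x (RecvCount x n)

data ReceiverFact (x : Refob) : Fact → Set where
  created  : ReceiverFact x (Created x)
  received : ∀ {n} → ReceiverFact x (RecvCount x n)

-- `G` and `L` are only upper bounds. A count listed in `L` may well be present afterwards, because
-- `setSent` and `setRecv` delete and then write.
record Change (κ κ' : Config) (G L : Actor → Fact → Set) : Set where
  constructor change
  field
    gain : ∀ {a f} → f ∈ know κ' a → f ∈ know κ a ⊎ G a f
    lose : ∀ {a f} → f ∈ know κ a → f ∈ know κ' a ⊎ L a f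

record Put (κ κ' : Config) (C : Actor) (m : Msg) : Set where
  constructor mkPut
  field put : ∀ a → μ κ' a ≡ upd (μ κ) C (m ∷ μ κ C) a

record Take (κ κ' : Config) (C : Actor) (m : Msg) : Set where
  constructor mkTake
  field
    {ms₁ ms₂} : List Msg
    took : μ κ C ≡ ms₁ ++ m ∷ ms₂
    take : ∀ a → μ κ' a ≡ upd (μ κ) C (ms₁ ++ ms₂) a

module _ {κ κ' : Config} {G L : Actor → Fact → Set} (Δ : Change κ κ' G L) (x : Refob) where

  open Change Δ

  act-keep : ¬ L (owner x) (Activated x) → act κ x ≤ act κ' x
  act-keep l = has-mono 0 λ p → [ inj₁ , ⊥-elim ∘ l ]′ (lose p)

  act-gain : ∀ k → (G (owner x) (Activated x) → 1 ≤ k) → act κ' x ≤ k + act κ x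
  act-gain k g = has-mono k λ p → [ inj₁ , inj₂ ∘ g ]′ (gain p)

  sent-same : (∀ {n} → ¬ G (owner x) (SentCount x n)) → (∀ {n} → ¬ L (owner x) (SentCount x n)) →
              ∀ {n} → Sent κ' x n → Sent κ x n
  sent-same g l = ⊢-sent-mono (λ _ p → [ id , ⊥-elim ∘ g ]′ (gain p)) (λ _ p → [ id , ⊥-elim ∘ l ]′ (lose p))

  recv-same : (∀ {n} → ¬ G (target x) (RecvCount x n)) → (∀ {n} → ¬ L (target x) (RecvCount x n)) →
              ∀ {n} → Recv κ' x n → Recv κ x n
  recv-same g l = ⊢-recv-mono (λ _ p → [ id , ⊥-elim ∘ g ]′ (gain p)) (λ _ p → [ id , ⊥-elim ∘ l ]′ (lose p))

  using-keep : (∀ {z} → ¬ L (owner x) (CreatedUsing x z)) →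
               ∀ {z} → CreatedUsing x z ∈ know κ (owner x) → CreatedUsing x z ∈ know κ' (owner x)
  using-keep l p = [ id , ⊥-elim ∘ l ]′ (lose p)

  created-keep : ¬ L (target x) (Created x) → Created x ∈ know κ (target x) → Created x ∈ know κ' (target x)
  created-keep l p = [ id , ⊥-elim ∘ l ]′ (lose p)

  dead-gain : ∀ k → (G (target x) (Released x) → 1 ≤ k) → dead κ' x ≤ k + dead κ x
  dead-gain k g = has-mono k λ p → [ inj₁ , inj₂ ∘ g ]′ (gain p)

  quietSender : car κ' x ≤ car κ x → (∀ {f} → SenderCount x f → ¬ G (owner x) f) →
                (∀ {f} → SenderFact x f → ¬ L (owner x) f) → SenderQuiet κ κ' x
  quietSender c g l = senderQuiet (+-mono-≤ (act-gain 0 (⊥-elim ∘ g activated)) c) c (act-keep (l (count activated)))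
    (sent-same (g sent) (l (count sent))) (using-keep (l creator))

  quietReceiver : (∀ {f} → ReceiverCount x f → ¬ G (target x) f) →
                  (∀ {f} → ReceiverFact x f → ¬ L (target x) f) → ReceiverQuiet κ κ' x
  quietReceiver g l = receiverQuiet (dead-gain 0 (⊥-elim ∘ g released)) (recv-same (g received) (l received))
    (created-keep (l created))

know-upd : ∀ κ A s → knowOf (upd (α κ) A (just s) A) ≡ knowOf (just s)
know-upd κ A s = cong knowOf (upd-same (α κ) A (just s))

module _ (κ : Config) {A : Actor} {Φ : Knowledge} (s : ActorState) (kA : know κ A ≡ Φ) where

  gains-upd : {G : Fact → Set} → (∀ {f} → f ∈ knowOf (just s) → f ∈ Φ ⊎ G f) →
    ∀ {a f} → f ∈ knowOf (upd (α κ) A (just s) a) → f ∈ know κ a ⊎ a ≡ A × G f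
  gains-upd h {a} {f} p with a ≟ A
  ... | no a≢A = inj₁ (subst (λ v → f ∈ knowOf v) (upd-other (α κ) (just s) a≢A) p)
  ... | yes refl = [ inj₁ ∘ subst (f ∈_) (sym kA) , inj₂ ∘ (refl ,_) ]′ (h (subst (f ∈_) (know-upd κ A s) p))

  losses-upd : {L : Fact → Set} → (∀ {f} → f ∈ Φ → f ∈ knowOf (just s) ⊎ L f) →
    ∀ {a f} → f ∈ know κ a → f ∈ knowOf (upd (α κ) A (just s) a) ⊎ a ≡ A × L f
  losses-upd h {a} {f} p with a ≟ A
  ... | no a≢A = inj₁ (subst (λ v → f ∈ knowOf v) (sym (upd-other (α κ) (just s) a≢A)) p)
  ... | yes refl = [ inj₁ ∘ subst (f ∈_) (sym (know-upd κ A s)) , inj₂ ∘ (refl ,_) ]′ (h (subst (f ∈_) kA p))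

module _ {κ κ' : Config} {C : Actor} {m : Msg} (p : Put κ κ' C m) where

  open Put p

  put-at : (w : Msg → ℕ) → tally w (μ κ' C) ≡ w m + tally w (μ κ C)
  put-at w rewrite put C | upd-same (μ κ) C (m ∷ μ κ C) = refl

  put-≤ : (w : Msg → ℕ) → ∀ a → tally w (μ κ' a) ≤ w m + tally w (μ κ a)
  put-≤ w a with a ≟ C
  ... | yes refl = ≤-reflexive (put-at w)
  ... | no a≢C rewrite put a | upd-other (μ κ) (m ∷ μ κ C) a≢C = m≤n+m _ _

  put-0 : (w : Msg → ℕ) → w m ≡ 0 → ∀ a → tally w (μ κ' a) ≡ tally w (μ κ a)
  put-0 w w0 a with a ≟ C
  ... | yes refl = trans (put-at w) (cong (_+ tally w (μ κ a)) w0)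
  ... | no a≢C rewrite put a | upd-other (μ κ) (m ∷ μ κ C) a≢C = refl

  put-∈⁺ : ∀ {a m'} → m' ∈ μ κ a → m' ∈ μ κ' a
  put-∈⁺ {a} p with a ≟ C
  ... | yes refl rewrite put a | upd-same (μ κ) a (m ∷ μ κ a) = there p
  ... | no a≢C rewrite put a | upd-other (μ κ) (m ∷ μ κ C) a≢C = p

  put-new : m ∈ μ κ' C
  put-new rewrite put C | upd-same (μ κ) C (m ∷ μ κ C) = here refl

  put-∈⁻ : ∀ {a m'} → m' ∈ μ κ' a → m' ∈ μ κ a ⊎ a ≡ C × m' ≡ m
  put-∈⁻ {a} p with a ≟ C
  ... | no a≢C rewrite put a | upd-other (μ κ) (m ∷ μ κ C) a≢C = inj₁ p
  ... | yes refl rewrite put a | upd-same (μ κ) a (m ∷ μ κ a) with p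
  ...   | here eq = inj₂ (refl , eq)
  ...   | there q = inj₁ q

  put-releasing : ∀ x {n} → releases x m ≡ 0 → Releasing κ' x n → Releasing κ x n
  put-releasing x r0 p with put-∈⁻ p
  ... | inj₁ q = q
  ... | inj₂ (_ , refl) = ⊥-elim (1+n≢0 (trans (sym (δ-refl x)) r0))

  put-quiet : ∀ x → countedOn x m ≡ 0 → releases x m ≡ 0 → MailQuiet κ κ' x
  put-quiet x c0 r0 = mailQuiet (put-0 (releases x) r0 (target x)) (put-0 (countedOn x) c0 (target x))
    (put-releasing x r0) put-∈⁺

module _ {κ κ' : Config} {C : Actor} {m : Msg} (t : Take κ κ' C m) where

  open Take t

  take-at : (w : Msg → ℕ) → tally w (μ κ C) ≡ w m + tally w (μ κ' C)
  take-at w rewrite take C | upd-same (μ κ) C (ms₁ ++ ms₂) = trans (cong (tally w) took) (tally-insert w ms₁ m ms₂)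

  take-≤ : (w : Msg → ℕ) → ∀ a → tally w (μ κ' a) ≤ tally w (μ κ a)
  take-≤ w a with a ≟ C
  ... | yes refl = ≤-trans (m≤n+m _ (w m)) (≤-reflexive (sym (take-at w)))
  ... | no a≢C rewrite take a | upd-other (μ κ) (ms₁ ++ ms₂) a≢C = ≤-refl

  take-0 : (w : Msg → ℕ) → w m ≡ 0 → ∀ a → tally w (μ κ' a) ≡ tally w (μ κ a)
  take-0 w w0 a with a ≟ C
  ... | yes refl = sym (trans (take-at w) (cong (_+ tally w (μ κ' a)) w0))
  ... | no a≢C rewrite take a | upd-other (μ κ) (ms₁ ++ ms₂) a≢C = refl

  take-old : m ∈ μ κ C
  take-old = subst (m ∈_) (sym took) (∈-insert ms₁)

  take-∈⁻ : ∀ {a m'} → m' ∈ μ κ' a → m' ∈ μ κ a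
  take-∈⁻ {a} p with a ≟ C
  ... | no a≢C rewrite take a | upd-other (μ κ) (ms₁ ++ ms₂) a≢C = p
  ... | yes refl rewrite take a | upd-same (μ κ) a (ms₁ ++ ms₂) | took =
    [ ∈-++⁺ˡ , ∈-++⁺ʳ ms₁ ∘ there ]′ (∈-++⁻ ms₁ p)

  take-∈⁺ : ∀ {a m'} → m' ∈ μ κ a → m' ∈ μ κ' a ⊎ a ≡ C × m' ≡ m
  take-∈⁺ {a} p with a ≟ C
  ... | no a≢C rewrite take a | upd-other (μ κ) (ms₁ ++ ms₂) a≢C = inj₁ p
  ... | yes refl rewrite take a | upd-same (μ κ) a (ms₁ ++ ms₂) | took with ∈-++⁻ ms₁ p
  ...   | inj₁ q = inj₁ (∈-++⁺ˡ q)
  ...   | inj₂ (here eq) = inj₂ (refl , eq)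
  ...   | inj₂ (there q) = inj₁ (∈-++⁺ʳ ms₁ q)

  take-elsewhere : ∀ x → target x ≢ C → MailQuiet κ κ' x
  take-elsewhere x t≢C = mailQuiet (cong (tally (releases x)) same) (cong (tally (countedOn x)) same)
    (subst (_ ∈_) same) (subst (_ ∈_) (sym same))
    where same = trans (take (target x)) (upd-other (μ κ) (ms₁ ++ ms₂) t≢C)

  take-quiet : ∀ x → countedOn x m ≡ 0 → releases x m ≡ 0 → MailQuiet κ κ' x
  take-quiet x c0 r0 = mailQuiet (take-0 (releases x) r0 (target x)) (take-0 (countedOn x) c0 (target x))
    take-∈⁻ λ p → case take-∈⁺ p of λ where
      (inj₁ q) → q
      (inj₂ (_ , refl)) → ⊥-elim (1+n≢0 (trans (sym (δ-refl x)) c0))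

  -- A delivery activates `x` only out of a message taken from the mailbox of its owner, so what
  -- `act` gains is lost by `car`.
  take-sender : ∀ {G L} → Change κ κ' G L → ∀ x →
    (G (owner x) (Activated x) → owner x ≡ C × 1 ≤ carriedBy x m) →
    (∀ {n} → ¬ G (owner x) (SentCount x n)) →
    (∀ {f} → SenderFact x f → ¬ L (owner x) f) → SenderQuiet κ κ' x
  take-sender Δ x g gs l = senderQuiet total (take-≤ (carriedBy x) (owner x))
    (act-keep Δ x (l (count activated))) (sent-same Δ x gs (l (count sent)))
    (using-keep Δ x (l creator))
    where
    total : act κ' x + car κ' x ≤ act κ x + car κ x
    total with owner x ≟ C
    ... | no o≢C = +-mono-≤ (act-gain Δ x 0 (⊥-elim ∘ o≢C ∘ proj₁ ∘ g)) (take-≤ (carriedBy x) (owner x))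
    ... | yes refl = ≤-trans (+-monoˡ-≤ (car κ' x) (act-gain Δ x (carriedBy x m) (proj₂ ∘ g)))
      (≤-reflexive (trans (cong (_+ car κ' x) (+-comm (carriedBy x m) (act κ x)))
        (trans (+-assoc (act κ x) _ _) (cong (act κ x +_) (sym (take-at (carriedBy x)))))))

freshness : ∀ {κ x} → RefobInv κ x → token x ∉ usedTok κ → act κ x ≡ 0 × car κ x ≡ 0 × rel κ x ≡ 0 × dead κ x ≡ 0
freshness {κ} {x} inv f = zero-sum (act κ x) (car κ x) (rel κ x) (RefobInv.fresh inv f)

fresh-bound : ∀ {κ κ' x k} → RefobInv κ x → token x ∉ usedTok κ →
  act κ' x ≤ act κ x → car κ' x ≤ k + car κ x → k ≤ 1 → act κ' x + car κ' x ≤ 1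
fresh-bound {k = k} inv f a c k≤1 with a0 , c0 , _ ← freshness inv f =
  ≤-trans (+-mono-≤ (≤-trans a (≤-reflexive a0)) (≤-trans c (≤-reflexive (trans (cong (k +_) c0) (+-identityʳ k))))) k≤1

∈-removeRecv⁻ : ∀ {x f Φ} → f ∈ removeRecv x Φ → f ∈ Φ
∈-removeRecv⁻ {x} f∈ = proj₁ (∈-discard⁻ (isRecvOf x) f∈)

compact-gain : ∀ {x f} Φ → f ∈ removeRecv x (remove (Released x) (remove (Created x) Φ)) → f ∈ Φ
compact-gain {x} Φ p = proj₁ (∈-remove⁻ {Φ = Φ} (proj₁ (∈-remove⁻ {Φ = remove (Created x) Φ}
  (∈-removeRecv⁻ {x} {Φ = remove (Released x) (remove (Created x) Φ)} p))))

compact-lose : ∀ {x f} Φ → f ∈ Φ → f ∈ removeRecv x (remove (Released x) (remove (Created x) Φ)) ⊎ Forgotten x f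
compact-lose {x} Φ p with ∈-remove⁺ {g = Created x} p
... | inj₂ eq = inj₂ (inj₁ eq)
... | inj₁ p₁ with ∈-remove⁺ {g = Released x} p₁
...   | inj₂ eq = inj₂ (inj₂ (inj₁ eq))
...   | inj₁ p₂ = [ inj₁ , inj₂ ∘ inj₂ ∘ inj₂ ]′ (∈-removeRecv⁺ {x} p₂)

same-mail : ∀ {κ κ' x} → μ κ' ≡ μ κ → MailQuiet κ κ' x
same-mail {x = x} eq = mailQuiet (cong (λ f → tally (releases x) (f (target x))) eq)
  (cong (λ f → tally (countedOn x) (f (target x))) eq)
  (λ {n} → subst (λ f → release x n ∈ f (target x)) eq)
  (λ {z} {b} → subst (λ f → info x z b ∈ f (target x)) (sym eq))

noChange : ∀ {κ κ'} → α κ' ≡ α κ → Change κ κ' (λ _ _ → ⊥) (λ _ _ → ⊥)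
noChange eq = change (λ {a} {f} p → inj₁ (subst (λ g → f ∈ knowOf (g a)) eq p))
                     (λ {a} {f} p → inj₁ (subst (λ g → f ∈ knowOf (g a)) (sym eq) p))

put-sender : ∀ {κ κ' C m G L} → Put κ κ' C m → Change κ κ' G L → ∀ x → carriedBy x m ≡ 0 →
  (∀ {f} → SenderCount x f → ¬ G (owner x) f) → (∀ {f} → SenderFact x f → ¬ L (owner x) f) → SenderQuiet κ κ' x
put-sender p Δ x c0 = quietSender Δ x (≤-reflexive (put-0 p (carriedBy x) c0 (owner x)))

-- The event of each rule

module Events {κ : Config} (inv : ConfigInv κ) where

  open ConfigInv inv

  act⇒used : ∀ {x} → Activated x ∈ know κ (owner x) → Used κ x
  act⇒used {x} a = alive⇒used (refobs x) (alive-act κ x (∈⇒has a))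

  internal-actor : ∀ {a s} → α κ a ≡ just s → a ∉ χ κ
  internal-actor eq e = case trans (sym eq) (extern e) of λ ()

  Gained Lost : ∀ {ℓ κ'} → Step κ ℓ κ' → Actor → Fact → Set

  Gained (spawn {A} {B = B} {x} {y} _ _ _ _ _) a f = a ≡ A × f ≡ Activated (x ∶ A ⇒ B) ⊎
    a ≡ B × f ∈ Created (x ∶ A ⇒ B) ∷ Created (y ∶ B ⇒ B) ∷ Activated (y ∶ B ⇒ B) ∷ []
  Gained (send {A} {x = y} {n} ys _ _ _ _ _ _) a f =
    a ≡ A × (f ≡ SentCount y (suc n) ⊎ ∃[ p ] p ∈ ys × f ≡ CreatedUsing (proj₁ p) (proj₂ p))
  Gained (receive {B} {x = y} {R} {n} _ _ _) a f =
    a ≡ B × (f ≡ RecvCount y (suc n) ⊎ ∃[ w ] w ∈ R × f ≡ Activated w)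
  Gained (receive⊥ {B} {R = R} _ _) a f = a ≡ B × ∃[ w ] w ∈ R × f ≡ Activated w
  Gained (sendInfo {A} {y = y} {n = n} _ _ _ _ _) a f = a ≡ A × f ≡ SentCount y (suc n)
  Gained (infoStep {C} {y = y} {z} {n = n} _ _ _) a f = a ≡ C × (f ≡ RecvCount y (suc n) ⊎ f ≡ Created z)
  Gained (releaseStep {B} {x = y} _ _ _) a f = a ≡ B × f ≡ Released y
  Gained _ _ _ = ⊥

  Lost (send {A} {x = y} _ _ _ _ _ _ _) a f = a ≡ A × ∃[ k ] f ≡ SentCount y k
  Lost (receive {B} {x = y} _ _ _) a f = a ≡ B × ∃[ k ] f ≡ RecvCount y k
  Lost (sendInfo {A} {y = y} {z} _ _ _ _ _) a f = a ≡ A × ((∃[ k ] f ≡ SentCount y k) ⊎ f ≡ CreatedUsing y z)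
  Lost (infoStep {C} {y = y} _ _ _) a f = a ≡ C × ∃[ k ] f ≡ RecvCount y k
  Lost (sendRelease {A} {x = y} {n} _ _ _ _ _) a f = a ≡ A × (f ≡ SentCount y n ⊎ f ≡ Activated y)
  Lost (compaction {C} {x = y} _ _ _) a f = a ≡ C × Forgotten y f
  Lost _ _ _ = ⊥

  changes : ∀ {ℓ κ'} (st : Step κ ℓ κ') → Change κ κ' (Gained st) (Lost st)
  changes {κ' = κ'} (spawn {A} {Φ} {B} {x} {y} αA B∉ _ _ _) = change gain lose
    where
    new : Knowledge
    new = Created (x ∶ A ⇒ B) ∷ Created (y ∶ B ⇒ B) ∷ Activated (y ∶ B ⇒ B) ∷ []
    s : ActorState
    s = busy (Activated (x ∶ A ⇒ B) ∷ Φ)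
    kA : know κ A ≡ Φ
    kA = cong knowOf αA
    gain : ∀ {a f} → f ∈ know κ' a → f ∈ know κ a ⊎ a ≡ A × f ≡ Activated (x ∶ A ⇒ B) ⊎ a ≡ B × f ∈ new
    gain {a} {f} p with a ≟ B
    ... | yes refl = inj₂ (inj₂ (refl , subst (λ v → f ∈ knowOf v) (upd-same (setα κ A s) a (just (busy new))) p))
    ... | no a≢B = [ inj₁ , inj₂ ∘ inj₁ ]′ (gains-upd κ s kA (λ where (here eq) → inj₂ eq ; (there q) → inj₁ q)
                     (subst (λ v → f ∈ knowOf v) (upd-other (setα κ A s) (just (busy new)) a≢B) p))
    lose : ∀ {a f} → f ∈ know κ a → f ∈ know κ' a ⊎ ⊥
    lose {a} {f} p with a ≟ B
    ... | yes refl = case subst (f ∈_) (cong knowOf (unusedAct B∉)) p of λ ()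
    ... | no a≢B = [ inj₁ ∘ subst (λ v → f ∈ knowOf v) (sym (upd-other (setα κ A s) (just (busy new)) a≢B)) , inj₂ ∘ proj₂ ]′
                     (losses-upd κ s kA (inj₁ ∘ there) p)
  changes (send {Φ = Φ} {y} {n} ys αA _ _ _ _ _) =
    change (gains-upd κ (busy Φ') kA gain)
           (losses-upd κ (busy Φ') kA (λ q → [ inj₁ ∘ ∈-++⁺ˡ , inj₂ ]′ (∈-setSent⁺ {y} q)))
    where
    cuOf : Refob × Refob → Fact
    cuOf p = CreatedUsing (proj₁ p) (proj₂ p)
    Φ' : Knowledge
    Φ' = setSent y (suc n) Φ ++ map cuOf ys
    kA = cong knowOf αA
    gain : ∀ {f} → f ∈ Φ' → f ∈ Φ ⊎ f ≡ SentCount y (suc n) ⊎ ∃[ p ] p ∈ ys × f ≡ cuOf p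
    gain q with ∈-++⁻ (setSent y (suc n) Φ) q
    ... | inj₁ q₁ = [ inj₁ , inj₂ ∘ inj₁ ]′ (∈-setSent⁻ {y} q₁)
    ... | inj₂ q₂ = inj₂ (inj₂ (∈-map⁻ cuOf q₂))
  changes (receive {Φ = Φ} {y} {R} {n} αB _ _) =
    change (gains-upd κ (busy Φ') kB gain)
           (losses-upd κ (busy Φ') kB (λ q → [ inj₁ ∘ ∈-++⁺ˡ , inj₂ ]′ (∈-setRecv⁺ {y} q)))
    where
    Φ' : Knowledge
    Φ' = setRecv y (suc n) Φ ++ map Activated R
    kB = cong knowOf αB
    gain : ∀ {f} → f ∈ Φ' → f ∈ Φ ⊎ f ≡ RecvCount y (suc n) ⊎ ∃[ w ] w ∈ R × f ≡ Activated w
    gain q with ∈-++⁻ (setRecv y (suc n) Φ) q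
    ... | inj₁ q₁ = [ inj₁ , inj₂ ∘ inj₁ ]′ (∈-setRecv⁻ {y} q₁)
    ... | inj₂ q₂ = inj₂ (inj₂ (∈-map⁻ Activated q₂))
  changes (receive⊥ {Φ = Φ} {R} αB _) =
    change (gains-upd κ (busy (Φ ++ map Activated R)) kB (λ q → [ inj₁ , inj₂ ∘ ∈-map⁻ Activated ]′ (∈-++⁻ Φ q)))
           (λ q → [ inj₁ , inj₂ ∘ proj₂ ]′ (losses-upd κ (busy (Φ ++ map Activated R)) kB (inj₁ ∘ ∈-++⁺ˡ) q))
    where kB = cong knowOf αB
  changes (idleStep {Φ = Φ} αA) =
    change (λ q → [ inj₁ , inj₂ ∘ proj₂ ]′ (gains-upd κ (idle Φ) (cong knowOf αA) inj₁ q))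
           (λ q → [ inj₁ , inj₂ ∘ proj₂ ]′ (losses-upd κ (idle Φ) (cong knowOf αA) inj₁ q))
  changes (sendInfo {Φ = Φ} {y} {z} {n} αA _ _ _ _) =
    change (gains-upd κ (busy (setSent y (suc n) Φ₀)) kA
             (λ q → [ inj₁ ∘ proj₁ ∘ ∈-remove⁻ {Φ = Φ} , inj₂ ]′ (∈-setSent⁻ {y} {Φ = Φ₀} q)))
           (losses-upd κ (busy (setSent y (suc n) Φ₀)) kA lose)
    where
    Φ₀ : Knowledge
    Φ₀ = remove (CreatedUsing y z) Φ
    kA = cong knowOf αA
    lose : ∀ {f} → f ∈ Φ → f ∈ setSent y (suc n) Φ₀ ⊎ (∃[ k ] f ≡ SentCount y k) ⊎ f ≡ CreatedUsing y z
    lose q with ∈-remove⁺ {g = CreatedUsing y z} q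
    ... | inj₂ eq = inj₂ (inj₂ eq)
    ... | inj₁ q' = [ inj₁ , inj₂ ∘ inj₁ ]′ (∈-setSent⁺ {y} q')
  changes (infoStep {Φ = Φ} {y} {z} {n = n} αC _ _) =
    change (gains-upd κ (idle Φ') kC gain)
           (losses-upd κ (idle Φ') kC (λ q → [ inj₁ ∘ ∈-++⁺ˡ , inj₂ ]′ (∈-setRecv⁺ {y} q)))
    where
    Φ' : Knowledge
    Φ' = setRecv y (suc n) Φ ++ Created z ∷ []
    kC = cong knowOf αC
    gain : ∀ {f} → f ∈ Φ' → f ∈ Φ ⊎ f ≡ RecvCount y (suc n) ⊎ f ≡ Created z
    gain q with ∈-++⁻ (setRecv y (suc n) Φ) q
    ... | inj₁ q₁ = [ inj₁ , inj₂ ∘ inj₁ ]′ (∈-setRecv⁻ {y} q₁)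
    ... | inj₂ (here eq) = inj₂ (inj₂ eq)
  changes (sendRelease {Φ = Φ} {y} {n} αA _ _ _ _) =
    change (λ q → [ inj₁ , inj₂ ∘ proj₂ ]′ (gains-upd κ (busy Φ') kA
             (λ q → inj₁ (proj₁ (∈-remove⁻ {Φ = Φ} (proj₁ (∈-remove⁻ {Φ = Φ₀} q))))) q))
           (losses-upd κ (busy Φ') kA lose)
    where
    Φ₀ Φ' : Knowledge
    Φ₀ = remove (Activated y) Φ
    Φ' = remove (SentCount y n) Φ₀
    kA = cong knowOf αA
    lose : ∀ {f} → f ∈ Φ → f ∈ Φ' ⊎ f ≡ SentCount y n ⊎ f ≡ Activated y
    lose q with ∈-remove⁺ {g = Activated y} q
    ... | inj₂ eq = inj₂ (inj₂ eq)
    ... | inj₁ q' = [ inj₁ , inj₂ ∘ inj₁ ]′ (∈-remove⁺ {g = SentCount y n} q')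
  changes (releaseStep {Φ = Φ} {y} αB _ _) =
    change (gains-upd κ (idle (Released y ∷ Φ)) kB (λ where (here eq) → inj₂ eq ; (there q) → inj₁ q))
           (λ q → [ inj₁ , inj₂ ∘ proj₂ ]′ (losses-upd κ (idle (Released y ∷ Φ)) kB (inj₁ ∘ there) q))
    where kB = cong knowOf αB
  changes (compaction {Φ = Φ} {y} αC _ _) =
    change (λ q → [ inj₁ , inj₂ ∘ proj₂ ]′ (gains-upd κ (idle Φ') kC (inj₁ ∘ compact-gain Φ) q))
           (losses-upd κ (idle Φ') kC (compact-lose Φ))
    where
    Φ' = removeRecv y (remove (Released y) (remove (Created y) Φ))
    kC = cong knowOf αC
  changes (snapshot _) = change inj₁ inj₁
  changes (inStep _ _ _ _) = change inj₁ inj₁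
  changes (out _ _) = change inj₁ inj₁
  changes (releaseOut _ _) = change inj₁ inj₁
  changes (infoOut _ _) = change inj₁ inj₁

  -- Traffic disappears uncounted only for refobs whose target is the external actor itself. For
  -- every other refob at most carried copies are lost, which `SenderQuiet` permits.
  drop-event : ∀ {κ' E m} → E ∈ χ κ → α κ' ≡ α κ → Take κ κ' E m → ∀ x → Event κ κ' x
  drop-event {κ'} {E} e αeq tk x = go (target x ≟ E)
    where
    Δ = noChange {κ} {κ'} αeq
    sender = take-sender tk Δ x (λ ()) (λ ()) (λ _ ())
    receiver = quietReceiver Δ x (λ _ ()) (λ _ ())
    go : Dec (target x ≡ E) → Event κ κ' x
    go (yes refl) = drop e sender receiver (take-≤ tk (releases x) (target x))
    go (no t≢E) = quiet sender receiver (take-elsewhere tk x t≢E)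

  event : ∀ {ℓ κ'} → Step κ ℓ κ' → ∀ x → Event κ κ' x
  event {κ' = κ'} st@(spawn {A} {Φ} {B} {x} {y} αA B∉ x∉ y∉ x≢y) z = go (z ≟ʳ X) (z ≟ʳ Y)
    where
    X Y : Refob
    X = x ∶ A ⇒ B
    Y = y ∶ B ⇒ B
    new : Knowledge
    new = Created X ∷ Created Y ∷ Activated Y ∷ []
    s : ActorState
    s = busy (Activated X ∷ Φ)
    Δ = changes st
    receiver : ReceiverQuiet κ κ' z
    receiver = quietReceiver Δ z
      (λ where
        released (inj₁ (_ , ()))
        released (inj₂ (_ , here ()))
        released (inj₂ (_ , there (here ())))
        released (inj₂ (_ , there (there (here ()))))
        received (inj₁ (_ , ()))
        received (inj₂ (_ , here ()))
        received (inj₂ (_ , there (here ())))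
        received (inj₂ (_ , there (there (here ())))))
      (λ _ ())
    sent-old : ∀ {n} → Sent κ' z n → Sent κ z n
    sent-old = sent-same Δ z
      (λ where
        (inj₁ (_ , ()))
        (inj₂ (_ , here ()))
        (inj₂ (_ , there (here ())))
        (inj₂ (_ , there (there (here ())))))
      (λ ())
    born : token z ∉ usedTok κ → token z ∈ usedTok κ' → target z ≡ B → Created z ∈ new → Event κ κ' z
    born f t eq c = create f t
      (+-mono-≤ (has≤1 (Activated z) (know κ' (owner z))) (≤-reflexive (proj₁ (proj₂ (freshness (refobs z) f)))))
      sent-old receiver (same-mail refl)
      (created (subst (λ v → Created z ∈ knowOf v)
        (sym (trans (cong (upd (setα κ A s) B (just (busy new))) eq) (upd-same (setα κ A s) B (just (busy new))))) c))
    go : Dec (z ≡ X) → Dec (z ≡ Y) → Event κ κ' z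
    go (yes refl) _ = born x∉ (here refl) refl (here refl)
    go (no _) (yes refl) = born y∉ (there (here refl)) refl (there (here refl))
    go (no z≢X) (no z≢Y) = quiet (quietSender Δ z ≤-refl
      (λ where
        activated (inj₁ (_ , refl)) → z≢X refl
        activated (inj₂ (_ , there (there (here refl)))) → z≢Y refl
        sent (inj₁ (_ , ()))
        sent (inj₂ (_ , here ()))
        sent (inj₂ (_ , there (here ())))
        sent (inj₂ (_ , there (there (here ())))))
      (λ _ ())) receiver (same-mail refl)
  event {κ' = κ'} st@(send {Φ = Φ} {y} {n} ys αA refl act-y specs distinct sent-y) z = go (z ≟ʳ y) (z ∈ʳ? R)
    where
    R : List Refob
    R = map proj₂ ys
    cuOf : Refob × Refob → Fact
    cuOf p = CreatedUsing (proj₁ p) (proj₂ p)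
    Φ' : Knowledge
    Φ' = setSent y (suc n) Φ ++ map cuOf ys
    kA : know κ (owner y) ≡ Φ
    kA = cong knowOf αA
    m : Msg
    m = app (just y) R
    Δ = changes st
    p : Put κ κ' (target y) m
    p = mkPut (λ _ → refl)
    receiver : ReceiverQuiet κ κ' z
    receiver = quietReceiver Δ z
      (λ where
        released (_ , inj₁ ())
        released (_ , inj₂ (_ , _ , ()))
        received (_ , inj₁ ())
        received (_ , inj₂ (_ , _ , ())))
      (λ where
        created (_ , _ , ())
        received (_ , _ , ()))
    actUp : act κ' z ≤ act κ z
    actUp = act-gain Δ z 0 λ where
      (_ , inj₁ ())
      (_ , inj₂ (_ , _ , ()))
    in-R : z ∈ R → token z ∉ usedTok κ
    in-R z∈ with q , q∈ , refl ← ∈-map⁻ proj₂ z∈ = proj₂ (proj₂ (proj₂ (proj₂ (All.lookup specs q∈))))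
    act∈ : ∀ {w} → owner w ≡ owner y → Φ ⊢ Activated w → Activated w ∈ know κ (owner w)
    act∈ {w} eq a = subst (Activated w ∈_) (sym (trans (cong (know κ) eq) kA)) (⊢-activated a)
    go : Dec (z ≡ y) → Dec (z ∈ R) → Event κ κ' z
    -- The refob used for sending is activated, so its token is in use and it is none of the fresh
    -- ones.
    go (yes refl) (yes z∈) = ⊥-elim (act⇒used (act∈ refl act-y) (in-R z∈))
    go (yes refl) (no z∉) = sendMsg (∈⇒has (act∈ refl act-y)) (act-keep Δ z λ where (_ , _ , ()))
      (+-mono-≤ actUp car≤) car≤
      (λ {n'} s → n , ⊢-sent-unique only (here refl) (subst (_⊢ SentCount z n') (know-upd κ (owner z) (busy Φ')) s)
                  , subst (_⊢ SentCount z n) (sym kA) sent-y)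
      (inj₁ ∘ using-keep Δ z (λ where (_ , _ , ())))
      receiver (put-0 p (releases z) refl (target z))
      (trans (put-at p (countedOn z)) (cong (_+ msgs κ z) (δ-refl z)))
      (put-releasing p z refl) (put-∈⁺ p)
      where
      car≤ : car κ' z ≤ car κ z
      car≤ = ≤-reflexive (put-0 p (carriedBy z) (tally-∉ z∉) (owner z))
      only : ∀ {j} → SentCount z j ∈ Φ' → j ≡ suc n
      only q with ∈-++⁻ (setSent z (suc n) Φ) q
      ... | inj₁ q₁ = setSent-unique {z} {Φ = Φ} q₁
      ... | inj₂ q₂ = case ∈-map⁻ cuOf q₂ of λ where (_ , _ , ())
    go (no z≢y) (yes z∈) with q , q∈ , refl ← ∈-map⁻ proj₂ z∈
      with o , a , _ , tz , f ← All.lookup specs q∈ = create f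
        (∈-++⁺ˡ (∈-map⁺ (λ p → token (proj₂ p)) q∈))
        (fresh-bound {κ} {κ'} (refobs z) f actUp (put-≤ p (carriedBy z) (owner z))
          (tally-unique (subst Unique (map-∘ ys) distinct)))
        (sent-same Δ z (λ where (_ , inj₁ refl) → z≢y refl ; (_ , inj₂ (_ , _ , ()))) (λ where (_ , _ , refl) → z≢y refl))
        receiver (put-quiet p z (δ-≢ z≢y) refl)
        (introduced (act∈ o a) (sym tz)
          (subst (cuOf q ∈_) (sym (trans (cong (know κ') o) (know-upd κ (owner y) (busy Φ'))))
            (∈-++⁺ʳ (setSent y (suc n) Φ) (∈-map⁺ cuOf q∈))))
    go (no z≢y) (no z∉) = quiet (put-sender p Δ z (tally-∉ z∉)
      (λ where
        activated (_ , inj₁ ())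
        activated (_ , inj₂ (_ , _ , ()))
        sent (_ , inj₁ refl) → z≢y refl
        sent (_ , inj₂ (_ , _ , ())))
      (λ where
        (count activated) (_ , _ , ())
        (count sent) (_ , _ , refl) → z≢y refl
        creator (_ , _ , ())))
      receiver (put-quiet p z (δ-≢ z≢y) refl)
  event {κ' = κ'} st@(receive {B} {Φ} {y} {R} {n} αB took recv-y) x = go (x ≟ʳ y)
    where
    m : Msg
    m = app (just y) R
    Φ' : Knowledge
    Φ' = setRecv y (suc n) Φ ++ map Activated R
    kB : know κ B ≡ Φ
    kB = cong knowOf αB
    Δ = changes st
    t : Take κ κ' B m
    t = mkTake took (λ _ → refl)
    sender : SenderQuiet κ κ' x
    sender = take-sender t Δ x
      (λ where
        (eq , inj₂ (_ , w∈ , refl)) → eq , ∈⇒1≤tally w∈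
        (_ , inj₁ ()))
      (λ where
        (_ , inj₁ ())
        (_ , inj₂ (_ , _ , ())))
      (λ where
        (count activated) (_ , _ , ())
        (count sent) (_ , _ , ())
        creator (_ , _ , ()))
    dead≤ : dead κ' x ≤ dead κ x
    dead≤ = dead-gain Δ x 0 λ where
      (_ , inj₁ ())
      (_ , inj₂ (_ , _ , ()))
    made : Created x ∈ know κ (target x) → Created x ∈ know κ' (target x)
    made = created-keep Δ x λ where (_ , _ , ())
    go : Dec (x ≡ y) → Event κ κ' x
    go (no x≢y) = quiet sender (receiverQuiet dead≤
      (recv-same Δ x (λ where (_ , inj₁ refl) → x≢y refl ; (_ , inj₂ (_ , _ , ()))) (λ where (_ , _ , refl) → x≢y refl))
      made) (take-quiet t x (δ-≢ x≢y) refl)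
    go (yes refl) with refl , _ ← mail (take-old t) = recvMsg (internal-actor αB) sender dead≤
      (λ {n'} s → n , ⊢-recv-unique only (here refl) (subst (_⊢ RecvCount x n') (know-upd κ B (busy Φ')) s)
                  , subst (_⊢ RecvCount x n) (sym kB) recv-y)
      made (take-0 t (releases x) refl (target x))
      (trans (take-at t (countedOn x)) (cong (_+ msgs κ' x) (δ-refl x)))
      (take-∈⁻ t)
      (λ q → case take-∈⁺ t q of λ where
        (inj₁ q') → inj₁ q'
        (inj₂ (_ , ())))
      where
      only : ∀ {j} → RecvCount x j ∈ Φ' → j ≡ suc n
      only q with ∈-++⁻ (setRecv x (suc n) Φ) q
      ... | inj₁ q₁ = setRecv-unique {x} {Φ = Φ} q₁
      ... | inj₂ q₂ = case ∈-map⁻ Activated q₂ of λ where (_ , _ , ())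
  event {κ' = κ'} st@(receive⊥ {B} {Φ} {R} αB took) x = quiet
    (take-sender t Δ x
      (λ where (eq , _ , w∈ , refl) → eq , ∈⇒1≤tally w∈)
      (λ where (_ , _ , _ , ()))
      (λ _ ()))
    (quietReceiver Δ x
      (λ where
        released (_ , _ , _ , ())
        received (_ , _ , _ , ()))
      (λ _ ()))
    (take-quiet t x refl refl)
    where
    Δ = changes st
    t : Take κ κ' B (app nothing R)
    t = mkTake took (λ _ → refl)
  event {κ' = κ'} st@(idleStep {A} {Φ} αA) x =
    quiet (quietSender Δ x ≤-refl (λ _ ()) (λ _ ())) (quietReceiver Δ x (λ _ ()) (λ _ ())) (same-mail refl)
    where
    Δ = changes st
  event {κ' = κ'} st@(sendInfo {Φ = Φ} {y} {z} {n} αA refl tz rec sent-y) x = go (x ≟ʳ y)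
    where
    m : Msg
    m = info y z (owner z)
    Φ₀ Φ' : Knowledge
    Φ₀ = remove (CreatedUsing y z) Φ
    Φ' = setSent y (suc n) Φ₀
    kA : know κ (owner y) ≡ Φ
    kA = cong knowOf αA
    Δ = changes st
    p : Put κ κ' (target y) m
    p = mkPut (λ _ → refl)
    receiver : ReceiverQuiet κ κ' x
    receiver = quietReceiver Δ x
      (λ where
        released (_ , ())
        received (_ , ()))
      (λ where
        created (_ , inj₁ (_ , ()))
        created (_ , inj₂ ())
        received (_ , inj₁ (_ , ()))
        received (_ , inj₂ ()))
    go : Dec (x ≡ y) → Event κ κ' x
    go (yes refl) = sendMsg (∈⇒has (usingAct (subst (CreatedUsing x z ∈_) (sym kA) rec)))
      (act-keep Δ x λ where
        (_ , inj₁ (_ , ()))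
        (_ , inj₂ ()))
      (+-mono-≤ (act-gain Δ x 0 λ where (_ , ())) car≤) car≤
      (λ {n'} s → n , ⊢-sent-unique (setSent-unique {x} {Φ = Φ₀}) (here refl)
                        (subst (_⊢ SentCount x n') (know-upd κ (owner x) (busy Φ')) s)
                  , subst (_⊢ SentCount x n) (sym kA) sent-y)
      (λ q → case Change.lose Δ q of λ where
        (inj₁ q') → inj₁ q'
        (inj₂ (_ , inj₁ (_ , ())))
        -- The deleted record lives on in the `info` message just sent.
        (inj₂ (_ , inj₂ refl)) → inj₂ (owner z , put-new p))
      receiver (put-0 p (releases x) refl (target x))
      (trans (put-at p (countedOn x)) (cong (_+ msgs κ x) (δ-refl x)))
      (put-releasing p x refl) (put-∈⁺ p)
      where
      car≤ : car κ' x ≤ car κ x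
      car≤ = ≤-reflexive (put-0 p (carriedBy x) refl (owner x))
    go (no x≢y) = quiet (put-sender p Δ x refl
      (λ where
        activated (_ , ())
        sent (_ , refl) → x≢y refl)
      (λ where
        (count activated) (_ , inj₁ (_ , ()))
        (count activated) (_ , inj₂ ())
        (count sent) (_ , inj₁ (_ , refl)) → x≢y refl
        (count sent) (_ , inj₂ ())
        creator (_ , inj₁ (_ , ()))
        creator (_ , inj₂ refl) → x≢y refl))
      receiver (put-quiet p x (δ-≢ x≢y) refl)
  event {κ' = κ'} st@(infoStep {C} {Φ} {y} {z} {b} {n} αC took recv-y) x = go (x ≟ʳ y)
    where
    m : Msg
    m = info y z b
    Φ' : Knowledge
    Φ' = setRecv y (suc n) Φ ++ Created z ∷ []
    kC : know κ C ≡ Φ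
    kC = cong knowOf αC
    Δ = changes st
    t : Take κ κ' C m
    t = mkTake took (λ _ → refl)
    sender : SenderQuiet κ κ' x
    sender = take-sender t Δ x
      (λ where
        (_ , inj₁ ())
        (_ , inj₂ ()))
      (λ where
        (_ , inj₁ ())
        (_ , inj₂ ()))
      (λ where
        (count activated) (_ , _ , ())
        (count sent) (_ , _ , ())
        creator (_ , _ , ()))
    dead≤ : dead κ' x ≤ dead κ x
    dead≤ = dead-gain Δ x 0 λ where
      (_ , inj₁ ())
      (_ , inj₂ ())
    made : Created x ∈ know κ (target x) → Created x ∈ know κ' (target x)
    made = created-keep Δ x λ where (_ , _ , ())
    go : Dec (x ≡ y) → Event κ κ' x
    go (no x≢y) = quiet sender (receiverQuiet dead≤
      (recv-same Δ x (λ where (_ , inj₁ refl) → x≢y refl ; (_ , inj₂ ())) (λ where (_ , _ , refl) → x≢y refl))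
      made) (take-quiet t x (δ-≢ x≢y) refl)
    go (yes refl) with refl ← mail (take-old t) = recvMsg (internal-actor αC) sender dead≤
      (λ {n'} s → n , ⊢-recv-unique only (here refl) (subst (_⊢ RecvCount x n') (know-upd κ C (idle Φ')) s)
                  , subst (_⊢ RecvCount x n) (sym kC) recv-y)
      made (take-0 t (releases x) refl (target x))
      (trans (take-at t (countedOn x)) (cong (_+ msgs κ' x) (δ-refl x)))
      (take-∈⁻ t)
      (λ q → case take-∈⁺ t q of λ where
        (inj₁ q') → inj₁ q'
        (inj₂ (_ , refl)) → inj₂ (subst (Created z ∈_) (sym (know-upd κ C (idle Φ')))
                                    (∈-++⁺ʳ (setRecv x (suc n) Φ) (here refl))))
      where
      only : ∀ {j} → RecvCount x j ∈ Φ' → j ≡ suc n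
      only q with ∈-++⁻ (setRecv x (suc n) Φ) q
      ... | inj₁ q₁ = setRecv-unique {x} {Φ = Φ} q₁
      ... | inj₂ (here ())
  event {κ' = κ'} st@(sendRelease {Φ = Φ} {y} {n} αA refl act-y sent-y no-using) x = go (x ≟ʳ y)
    where
    m : Msg
    m = release y n
    Φ₀ Φ' : Knowledge
    Φ₀ = remove (Activated y) Φ
    Φ' = remove (SentCount y n) Φ₀
    kA : know κ (owner y) ≡ Φ
    kA = cong knowOf αA
    Δ = changes st
    p : Put κ κ' (target y) m
    p = mkPut (λ _ → refl)
    receiver : ReceiverQuiet κ κ' x
    receiver = quietReceiver Δ x (λ _ ())
      (λ where
        created (_ , inj₁ ())
        created (_ , inj₂ ())
        received (_ , inj₁ ())
        received (_ , inj₂ ()))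
    go : Dec (x ≡ y) → Event κ κ' x
    go (yes refl) = sendRel (∈⇒has (subst (Activated x ∈_) (sym kA) (⊢-activated act-y)))
      (∉⇒has λ q → proj₂ (∈-remove⁻ {Φ = Φ} (proj₁ (∈-remove⁻ {Φ = Φ₀} (subst (Activated x ∈_) (know-upd κ (owner x) (busy Φ')) q)))) refl)
      (≤-reflexive (put-0 p (carriedBy x) refl (owner x)))
      (no-using _ ∘ subst (_ ∈_) kA)
      receiver (trans (put-at p (releases x)) (cong (_+ rel κ x) (δ-refl x)))
      (put-0 p (countedOn x) refl (target x))
      (λ q → case put-∈⁻ p q of λ where
        (inj₁ q') → inj₁ q'
        (inj₂ (_ , refl)) → inj₂ (subst (_⊢ SentCount x n) (sym kA) sent-y))
      (put-∈⁺ p)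
    go (no x≢y) = quiet (put-sender p Δ x refl (λ _ ())
      (λ where
        (count activated) (_ , inj₁ ())
        (count activated) (_ , inj₂ refl) → x≢y refl
        (count sent) (_ , inj₁ refl) → x≢y refl
        (count sent) (_ , inj₂ ())
        creator (_ , inj₁ ())
        creator (_ , inj₂ ())))
      receiver (put-quiet p x refl (δ-≢ x≢y))
  event {κ' = κ'} st@(releaseStep {B} {Φ} {y} {n} αB took recv-y) x = go (x ≟ʳ y)
    where
    kB : know κ B ≡ Φ
    kB = cong knowOf αB
    Δ = changes st
    t : Take κ κ' B (release y n)
    t = mkTake took (λ _ → refl)
    sender : SenderQuiet κ κ' x
    sender = take-sender t Δ x (λ where (_ , ())) (λ where (_ , ())) (λ _ ())
    recv-old : ∀ {k} → Recv κ' x k → Recv κ x k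
    recv-old = recv-same Δ x (λ where (_ , ())) (λ ())
    made : Created x ∈ know κ (target x) → Created x ∈ know κ' (target x)
    made = created-keep Δ x (λ ())
    go : Dec (x ≡ y) → Event κ κ' x
    go (no x≢y) = quiet sender
      (receiverQuiet (dead-gain Δ x 0 λ where (_ , refl) → ⊥-elim (x≢y refl)) recv-old made)
      (take-quiet t x refl (δ-≢ x≢y))
    go (yes refl) with refl , _ ← mail (take-old t) = recvRel (internal-actor αB) sender
      (take-old t) (subst (_⊢ RecvCount x n) (sym kB) recv-y)
      (dead-gain Δ x 1 λ _ → ≤-refl) recv-old made
      (trans (take-at t (releases x)) (cong (_+ rel κ' x) (δ-refl x)))
      (take-0 t (countedOn x) refl (target x)) (take-∈⁻ t)
      (λ q → case take-∈⁺ t q of λ where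
        (inj₁ q') → q'
        (inj₂ (_ , ())))
  event {κ' = κ'} st@(compaction {C} {Φ} {y} αC created-y released-y) x = go (x ≟ʳ y)
    where
    kC : know κ C ≡ Φ
    kC = cong knowOf αC
    Δ = changes st
    sender : SenderQuiet κ κ' x
    sender = quietSender Δ x ≤-refl (λ _ ())
      (λ where
        (count activated) (_ , inj₁ ())
        (count activated) (_ , inj₂ (inj₁ ()))
        (count activated) (_ , inj₂ (inj₂ ()))
        (count sent) (_ , inj₁ ())
        (count sent) (_ , inj₂ (inj₁ ()))
        (count sent) (_ , inj₂ (inj₂ ()))
        creator (_ , inj₁ ())
        creator (_ , inj₂ (inj₁ ()))
        creator (_ , inj₂ (inj₂ ())))
    go : Dec (x ≡ y) → Event κ κ' x
    go (no x≢y) = quiet sender (quietReceiver Δ x (λ _ ())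
      (λ where
        created (_ , inj₁ refl) → x≢y refl
        created (_ , inj₂ (inj₁ ()))
        created (_ , inj₂ (inj₂ ()))
        received (_ , inj₁ ())
        received (_ , inj₂ (inj₁ ()))
        received (_ , inj₂ (inj₂ (_ , refl))) → x≢y refl)) (same-mail refl)
    -- A `Released` fact sits at the target of its refob, so the compacting actor is the one whose
    -- `dead` is measured.
    go (yes refl) with r ← subst (Released x ∈_) (sym kC) released-y
      with refl , _ ← releasedAt r = compact (∈⇒has r) (dead-gain Δ x 0 λ ()) sender (same-mail refl)
  event st@(snapshot _) x =
    quiet (quietSender Δ x ≤-refl (λ _ ()) (λ _ ())) (quietReceiver Δ x (λ _ ()) (λ _ ())) (same-mail refl)
    where Δ = changes st
  event {κ' = κ'} st@(inStep {A} R A∈ specs distinct) x = go (x ∈ʳ? R)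
    where
    Δ = changes st
    p : Put κ κ' A (app nothing R)
    p = mkPut (λ _ → refl)
    receiver = quietReceiver Δ x (λ _ ()) (λ _ ())
    go : Dec (x ∈ R) → Event κ κ' x
    go (no x∉) = quiet (put-sender p Δ x (tally-∉ x∉) (λ _ ()) (λ _ ())) receiver (put-quiet p x refl refl)
    go (yes x∈) with _ , tx , f ← All.lookup specs x∈ = create f (∈-++⁺ˡ (∈-map⁺ token x∈))
      (fresh-bound {κ} {κ'} (refobs x) f ≤-refl (put-≤ p (carriedBy x) (owner x)) (tally-unique distinct))
      (sent-same Δ x (λ ()) (λ ())) receiver (put-quiet p x refl refl)
      ([ receptionist , external ]′ tx)
  event (out e took) = drop-event e refl (mkTake took (λ _ → refl))
  event (releaseOut e took) = drop-event e refl (mkTake took (λ _ → refl))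
  event (infoOut e took) = drop-event e refl (mkTake took (λ _ → refl))

-- Steps preserve the invariant

χ-step : ∀ {κ ℓ κ'} → Step κ ℓ κ' → χ κ' ≡ χ κ
χ-step (spawn _ _ _ _ _) = refl
χ-step (send _ _ _ _ _ _ _) = refl
χ-step (receive _ _ _) = refl
χ-step (receive⊥ _ _) = refl
χ-step (idleStep _) = refl
χ-step (sendInfo _ _ _ _ _) = refl
χ-step (infoStep _ _ _) = refl
χ-step (sendRelease _ _ _ _ _) = refl
χ-step (releaseStep _ _ _) = refl
χ-step (compaction _ _ _) = refl
χ-step (snapshot _) = refl
χ-step (inStep _ _ _ _) = refl
χ-step (out _ _) = refl
χ-step (releaseOut _ _) = refl
χ-step (infoOut _ _) = refl

usedTok-step : ∀ {κ ℓ κ' t} → Step κ ℓ κ' → t ∈ usedTok κ → t ∈ usedTok κ'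
usedTok-step (spawn _ _ _ _ _) = there ∘ there
usedTok-step (send ys _ _ _ _ _ _) = ∈-++⁺ʳ (map (λ p → token (proj₂ p)) ys)
usedTok-step (receive _ _ _) = id
usedTok-step (receive⊥ _ _) = id
usedTok-step (idleStep _) = id
usedTok-step (sendInfo _ _ _ _ _) = id
usedTok-step (infoStep _ _ _) = id
usedTok-step (sendRelease _ _ _ _ _) = id
usedTok-step (releaseStep _ _ _) = id
usedTok-step (compaction _ _ _) = id
usedTok-step (snapshot _) = id
usedTok-step (inStep R _ _ _) = ∈-++⁺ʳ (map token R)
usedTok-step (out _ _) = id
usedTok-step (releaseOut _ _) = id
usedTok-step (infoOut _ _) = id

module StepInv {κ : Config} (inv : ConfigInv κ) where

  open ConfigInv inv
  open Events inv

  usedAct-step : ∀ {ℓ κ' a} → Step κ ℓ κ' → a ∈ usedAct κ → a ∈ usedAct κ'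
  usedAct-step (spawn _ _ _ _ _) = there
  usedAct-step (send _ _ _ _ _ _ _) = id
  usedAct-step (receive _ _ _) = id
  usedAct-step (receive⊥ _ _) = id
  usedAct-step (idleStep _) = id
  usedAct-step (sendInfo _ _ _ _ _) = id
  usedAct-step (infoStep _ _ _) = id
  usedAct-step (sendRelease _ _ _ _ _) = id
  usedAct-step (releaseStep _ _ _) = id
  usedAct-step (compaction _ _ _) = id
  usedAct-step (snapshot _) = id
  usedAct-step (inStep _ _ _ _) = id
  usedAct-step (out _ _) = id
  usedAct-step (releaseOut _ _) = id
  usedAct-step (infoOut _ _) = id

  domain-upd : ∀ {A s s' a} → α κ A ≡ just s' → α κ a ≡ nothing → setα κ A s a ≡ nothing
  domain-upd {A} {s} αA αa = trans (upd-other (α κ) (just s) λ where refl → case trans (sym αA) αa of λ ()) αa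

  domain-step : ∀ {ℓ κ' a} → Step κ ℓ κ' → α κ a ≡ nothing → α κ' a ≡ nothing ⊎ a ∉ usedAct κ × a ∈ usedAct κ'
  domain-step {a = a} (spawn {A} {Φ} {B} {x} {y} αA B∉ _ _ _) αa with a ≟ B
  ... | yes refl = inj₂ (B∉ , here refl)
  ... | no a≢B = inj₁ (trans (upd-other (setα κ A (busy (Activated (x ∶ A ⇒ B) ∷ Φ))) _ a≢B) (domain-upd αA αa))
  domain-step (send _ αA _ _ _ _ _) αa = inj₁ (domain-upd αA αa)
  domain-step (receive αA _ _) αa = inj₁ (domain-upd αA αa)
  domain-step (receive⊥ αA _) αa = inj₁ (domain-upd αA αa)
  domain-step (idleStep αA) αa = inj₁ (domain-upd αA αa)
  domain-step (sendInfo αA _ _ _ _) αa = inj₁ (domain-upd αA αa)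
  domain-step (infoStep αA _ _) αa = inj₁ (domain-upd αA αa)
  domain-step (sendRelease αA _ _ _ _) αa = inj₁ (domain-upd αA αa)
  domain-step (releaseStep αA _ _) αa = inj₁ (domain-upd αA αa)
  domain-step (compaction αA _ _) αa = inj₁ (domain-upd αA αa)
  domain-step (snapshot _) αa = inj₁ αa
  domain-step (inStep _ _ _ _) αa = inj₁ αa
  domain-step (out _ _) αa = inj₁ αa
  domain-step (releaseOut _ _) αa = inj₁ αa
  domain-step (infoOut _ _) αa = inj₁ αa

  ρ-step : ∀ {ℓ κ' a} → Step κ ℓ κ' → a ∈ ρ κ → a ∈ ρ κ'
  ρ-step (spawn _ _ _ _ _) = id
  ρ-step (send _ _ _ _ _ _ _) = id
  ρ-step (receive _ _ _) = id
  ρ-step (receive⊥ _ _) = id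
  ρ-step (idleStep _) = id
  ρ-step (sendInfo _ _ _ _ _) = id
  ρ-step (infoStep _ _ _) = id
  ρ-step (sendRelease _ _ _ _ _) = id
  ρ-step (releaseStep _ _ _) = id
  ρ-step (compaction _ _ _) = id
  ρ-step (snapshot _) = id
  ρ-step (inStep _ _ _ _) = id
  ρ-step (out _ _) = ∈-++⁺ˡ
  ρ-step (releaseOut _ _) = id
  ρ-step (infoOut _ _) = id

  -- A new receptionist is the target of a refob just delivered to an external actor. Before the
  -- step that refob was still carried, hence alive, so `chained` applies to it one last time.
  ρ-new : ∀ {ℓ κ' b} → Step κ ℓ κ' → b ∈ ρ κ' →
    b ∈ ρ κ ⊎ b ∉ χ κ × ∃[ z ] owner z ∈ χ κ × target z ≡ b × Alive κ z
  ρ-new (spawn _ _ _ _ _) = inj₁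
  ρ-new (send _ _ _ _ _ _ _) = inj₁
  ρ-new (receive _ _ _) = inj₁
  ρ-new (receive⊥ _ _) = inj₁
  ρ-new (idleStep _) = inj₁
  ρ-new (sendInfo _ _ _ _ _) = inj₁
  ρ-new (infoStep _ _ _) = inj₁
  ρ-new (sendRelease _ _ _ _ _) = inj₁
  ρ-new (releaseStep _ _ _) = inj₁
  ρ-new (compaction _ _ _) = inj₁
  ρ-new (snapshot _) = inj₁
  ρ-new (inStep _ _ _ _) = inj₁
  ρ-new {κ' = κ'} {b} (out {E} {x} {R} {ms₁} {ms₂} e took) b∈ with ∈-++⁻ (ρ κ) b∈
  ... | inj₁ old = inj₁ old
  ... | inj₂ new with b∈R , known ← ∈-filter⁻ (T? ∘ is-just ∘ α κ) new
    with z , z∈ , refl ← ∈-map⁻ target b∈R = inj₂ (internal , z , subst (_∈ χ κ) (sym own) e , refl , alive-car κ z car≥1)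
    where
    m∈ : app x R ∈ μ κ E
    m∈ = take-old {κ} {κ'} {E} {app x R} (mkTake took (λ _ → refl))
    owners : ∀ w → MsgInv κ E (app w R) → All (λ z → owner z ≡ E) R
    owners (just _) = proj₂
    owners nothing = proj₂
    own : owner z ≡ E
    own = All.lookup (owners x (mail m∈)) z∈
    car≥1 : 1 ≤ car κ z
    car≥1 = ≤-trans (∈⇒1≤tally z∈) (∈⇒≤tally (carriedBy z) (subst (λ a → app x R ∈ μ κ a) (sym own) m∈))
    internal : target z ∉ χ κ
    internal c = subst (T ∘ is-just) (extern c) known
  ρ-new (releaseOut _ _) = inj₁
  ρ-new (infoOut _ _) = inj₁

  msgInv-step : ∀ {ℓ κ' a} (st : Step κ ℓ κ') m → MsgInv κ a m → MsgInv κ' a m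
  msgInv-step st (app (just _) _) i = i
  msgInv-step st (app nothing _) (r , i) = ρ-step st r , i
  msgInv-step st (info _ _ _) i = i
  msgInv-step st (release _ _) (t , o) = t , subst (_ ∉_) (sym (χ-step st)) o

  put-mail : ∀ {κ' C m} → Put κ κ' C m → MsgInv κ C m → ∀ {a m'} → m' ∈ μ κ' a → MsgInv κ a m'
  put-mail p i q with put-∈⁻ p q
  ... | inj₁ q' = mail q'
  ... | inj₂ (refl , refl) = i

  take-mail : ∀ {κ' C m} → Take κ κ' C m → ∀ {a m'} → m' ∈ μ κ' a → MsgInv κ a m'
  take-mail t q = mail (take-∈⁻ t q)

  mail-step : ∀ {ℓ κ' a m} → Step κ ℓ κ' → m ∈ μ κ' a → MsgInv κ a m
  mail-step (spawn _ _ _ _ _) q = mail q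
  mail-step {κ' = κ'} (send {x = y} ys _ _ _ specs _ _) q = put-mail {κ'} {target y} (mkPut λ _ → refl)
    (refl , All.tabulate λ z∈ → case ∈-map⁻ proj₂ z∈ of λ where
      (_ , p∈ , refl) → proj₁ (proj₂ (proj₂ (All.lookup specs p∈)))) q
  mail-step {κ' = κ'} (receive _ took _) q = take-mail {κ'} (mkTake took λ _ → refl) q
  mail-step {κ' = κ'} (receive⊥ _ took) q = take-mail {κ'} (mkTake took λ _ → refl) q
  mail-step (idleStep _) q = mail q
  mail-step {κ' = κ'} (sendInfo {y = y} _ _ _ _ _) q = put-mail {κ'} {target y} (mkPut λ _ → refl) refl q
  mail-step {κ' = κ'} (infoStep _ took _) q = take-mail {κ'} (mkTake took λ _ → refl) q
  mail-step {κ' = κ'} (sendRelease {x = y} αA refl _ _ _) q =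
    put-mail {κ'} {target y} (mkPut λ _ → refl) (refl , internal-actor αA) q
  mail-step {κ' = κ'} (releaseStep _ took _) q = take-mail {κ'} (mkTake took λ _ → refl) q
  mail-step (compaction _ _ _) q = mail q
  mail-step (snapshot _) q = mail q
  mail-step {κ' = κ'} (inStep {A} R A∈ specs _) q =
    put-mail {κ'} {A} (mkPut λ _ → refl) (A∈ , All.map proj₁ specs) q
  mail-step {κ' = κ'} (out _ took) q = take-mail {κ'} (mkTake took λ _ → refl) q
  mail-step {κ' = κ'} (releaseOut _ took) q = take-mail {κ'} (mkTake took λ _ → refl) q
  mail-step {κ' = κ'} (infoOut _ took) q = take-mail {κ'} (mkTake took λ _ → refl) q

  gained-released : ∀ {ℓ κ' a x} (st : Step κ ℓ κ') → Gained st a (Released x) → target x ≡ a × owner x ∉ χ κ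
  gained-released (spawn _ _ _ _ _) (inj₁ (_ , ()))
  gained-released (spawn _ _ _ _ _) (inj₂ (_ , here ()))
  gained-released (spawn _ _ _ _ _) (inj₂ (_ , there (here ())))
  gained-released (spawn _ _ _ _ _) (inj₂ (_ , there (there (here ()))))
  gained-released (send _ _ _ _ _ _ _) (_ , inj₁ ())
  gained-released (send _ _ _ _ _ _ _) (_ , inj₂ (_ , _ , ()))
  gained-released (receive _ _ _) (_ , inj₁ ())
  gained-released (receive _ _ _) (_ , inj₂ (_ , _ , ()))
  gained-released (receive⊥ _ _) (_ , _ , _ , ())
  gained-released (sendInfo _ _ _ _ _) (_ , ())
  gained-released (infoStep _ _ _) (_ , inj₁ ())
  gained-released (infoStep _ _ _) (_ , inj₂ ())
  gained-released {κ' = κ'} (releaseStep _ took _) (refl , refl) =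
    mail (take-old {κ} {κ'} (mkTake took λ _ → refl))

  gained-using : ∀ {ℓ κ' a x z} (st : Step κ ℓ κ') → Gained st a (CreatedUsing x z) →
    a ≡ owner x → Activated x ∈ know κ a × ¬ Lost st a (Activated x)
  gained-using (spawn _ _ _ _ _) (inj₁ (_ , ()))
  gained-using (spawn _ _ _ _ _) (inj₂ (_ , here ()))
  gained-using (spawn _ _ _ _ _) (inj₂ (_ , there (here ())))
  gained-using (spawn _ _ _ _ _) (inj₂ (_ , there (there (here ()))))
  gained-using (send _ _ _ _ _ _ _) (_ , inj₁ ())
  gained-using {x = x} (send _ αA _ _ specs _ _) (refl , inj₂ (_ , p∈ , refl)) _ =
    subst (Activated x ∈_) (sym (cong knowOf αA)) (⊢-activated (proj₁ (proj₂ (All.lookup specs p∈)))) ,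
    λ where (_ , _ , ())
  gained-using (receive _ _ _) (_ , inj₁ ())
  gained-using (receive _ _ _) (_ , inj₂ (_ , _ , ()))
  gained-using (receive⊥ _ _) (_ , _ , _ , ())
  gained-using (sendInfo _ _ _ _ _) (_ , ())
  gained-using (infoStep _ _ _) (_ , inj₁ ())
  gained-using (infoStep _ _ _) (_ , inj₂ ())
  gained-using (releaseStep _ _ _) (_ , ())

  activated-step : ∀ {κ' x z} → Event κ κ' x → CreatedUsing x z ∈ know κ (owner x) → Activated x ∈ know κ' (owner x)
  activated-step {κ'} {x} e rec = has⇒∈ (go e)
    where
    1≤act : 1 ≤ act κ x
    1≤act = ∈⇒has (usingAct rec)
    keep : SenderQuiet κ κ' x → 1 ≤ act κ' x
    keep s = ≤-trans 1≤act (SenderQuiet.kept s)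
    go : Event κ κ' x → 1 ≤ act κ' x
    go (quiet s _ _) = keep s
    go (create f _ _ _ _ _ _) = ⊥-elim (act⇒used (usingAct rec) f)
    go (sendMsg _ k _ _ _ _ _ _ _ _ _) = ≤-trans 1≤act k
    go (recvMsg _ s _ _ _ _ _ _ _) = keep s
    go (sendRel _ _ _ u _ _ _ _ _) = ⊥-elim (u rec)
    go (recvRel _ s _ _ _ _ _ _ _ _ _) = keep s
    go (compact _ _ s _) = keep s
    go (drop _ s _ _) = keep s

  step-inv : ∀ {ℓ κ'} → Step κ ℓ κ' → ConfigInv κ'
  step-inv {κ' = κ'} st = record
    { refobs = λ x → Preservation.preserve (χ-step st) (usedTok-step st) (refobs x) (event st x)
    ; extern = λ e → [ id , (λ where (u , _) → ⊥-elim (u (externUsed (old e)))) ]′ (domain-step st (extern (old e)))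
    ; externUsed = λ e → usedAct-step st (externUsed (old e))
    ; unusedAct = λ u → [ id , (λ where (_ , v) → ⊥-elim (u v)) ]′ (domain-step st (unusedAct (u ∘ usedAct-step st)))
    ; mail = λ {a} {m} q → msgInv-step st m (mail-step st q)
    ; releasedAt = λ {a} {x} q → released' (Change.gain (changes st) q)
    ; usingAct = λ {x} {z} q → activated' (Change.gain (changes st) q)
    ; chained = chained-step
    ; reception = λ b∈ → reception' (ρ-new st b∈)
    }
    where
    open ChainStep inv (χ-step st) (ρ-step st) (event st)
    old : ∀ {a} → a ∈ χ κ' → a ∈ χ κ
    old = subst (_ ∈_) (χ-step st)
    new : ∀ {a} → a ∈ χ κ → a ∈ χ κ'
    new = subst (_ ∈_) (sym (χ-step st))
    released' : ∀ {a x} → Released x ∈ know κ a ⊎ Gained st a (Released x) → target x ≡ a × owner x ∉ χ κ'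
    released' r with t , o ← [ releasedAt , gained-released st ]′ r = t , o ∘ old
    activated' : ∀ {x z} → CreatedUsing x z ∈ know κ (owner x) ⊎ Gained st (owner x) (CreatedUsing x z) →
      Activated x ∈ know κ' (owner x)
    activated' {x} (inj₁ q) = activated-step (event st x) q
    activated' (inj₂ g) with a , ¬l ← gained-using st g refl = [ id , ⊥-elim ∘ ¬l ]′ (Change.lose (changes st) a)
    reception' : ∀ {b} → b ∈ ρ κ ⊎ b ∉ χ κ × ∃[ z ] owner z ∈ χ κ × target z ≡ b × Alive κ z →
      b ∉ χ κ' × ∃[ z ] owner z ∈ χ κ' × target z ≡ b × Chain κ' z
    reception' (inj₁ b∈) = reception-step b∈
    reception' (inj₂ (b∉ , z , o , refl , a)) with chained a b∉
    ... | inj₁ ch = b∉ ∘ old , z , new o , refl , chain-step ch (inj₁ a) b∉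
    ... | inj₂ b∈ = reception-step b∈

-- The initial configuration

initial-inv : ∀ {A E x y} → A ≢ E → ConfigInv (initConfig A E x y)
initial-inv {A} {E} {x} {y} A≢E = record
  { refobs = refob
  ; extern = λ where (here refl) → upd-other (λ _ → nothing) (just (busy Φ)) (A≢E ∘ sym)
  ; externUsed = λ where (here refl) → there (here refl)
  ; unusedAct = λ {a} u → upd-other (λ _ → nothing) (just (busy Φ)) {a} λ where refl → u (here refl)
  ; mail = λ ()
  ; releasedAt = λ {a} q → case known a q of λ where
      (_ , here ())
      (_ , there (here ()))
      (_ , there (there (here ())))
  ; usingAct = λ {z} q → case known (owner z) q of λ where
      (_ , here ())
      (_ , there (here ()))
      (_ , there (there (here ())))
  ; chained = λ {z} a i → chain z (proj₂ (known (owner z) (has⇒∈ (subst (1 ≤_) (trans (+-identityʳ _) (+-identityʳ _)) a)))) i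
  ; reception = λ ()
  }
  where
  κ = initConfig A E x y
  X Y : Refob
  X = x ∶ A ⇒ E
  Y = y ∶ A ⇒ A
  Φ : Knowledge
  Φ = Activated X ∷ Created Y ∷ Activated Y ∷ []
  knowA : know κ A ≡ Φ
  knowA = cong knowOf (upd-same (λ _ → nothing) A (just (busy Φ)))
  known : ∀ a {f} → f ∈ know κ a → a ≡ A × f ∈ Φ
  known a {f} q with a ≟ A
  ... | yes refl = refl , subst (f ∈_) knowA q
  ... | no a≢A = case subst (λ v → f ∈ knowOf v) (upd-other (λ _ → nothing) (just (busy Φ)) a≢A) q of λ ()
  no-dead : ∀ z → dead κ z ≡ 0
  no-dead z = ∉⇒has λ q → case known (target z) q of λ where
    (_ , here ())
    (_ , there (here ()))
    (_ , there (there (here ())))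
  sent0' : ∀ z {n} → Sent κ z n → n ≡ 0
  sent0' z (sent0 _) = refl
  sent0' z (ax q) = case known (owner z) q of λ where
    (_ , here ())
    (_ , there (here ()))
    (_ , there (there (here ())))
  recv0' : ∀ z {n} → Recv κ z n → n ≡ 0
  recv0' z (recv0 _) = refl
  recv0' z (ax q) = case known (target z) q of λ where
    (_ , here ())
    (_ , there (here ()))
    (_ , there (there (here ())))
  token-used : ∀ {z} → Activated z ∈ Φ → token z ∈ usedTok κ
  token-used (here refl) = here refl
  token-used (there (there (here refl))) = there (here refl)
  sum : ∀ z → act κ z + car κ z + rel κ z + dead κ z ≡ act κ z
  sum z = trans (cong₂ _+_ (trans (+-identityʳ _) (+-identityʳ _)) (no-dead z)) (+-identityʳ _)
  refob : ∀ z → RefobInv κ z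
  refob z = record
    { uniq = ≤-trans (≤-reflexive (sum z)) (has≤1 (Activated z) (know κ (owner z)))
    ; carrier = λ _ ()
    ; actCount = λ _ _ s r → trans (sent0' z s) (sym (trans (+-identityʳ _) (recv0' z r)))
    ; relCount = λ _ ()
    ; unborn = λ _ → sent0' z , recv0' z
    ; fresh = λ f → trans (sum z) (∉⇒has (f ∘ token-used ∘ proj₂ ∘ known (owner z)))
    }
  chain : ∀ z → Activated z ∈ Φ → Internal κ z → Chain κ z ⊎ target z ∈ []
  chain z (here refl) i = ⊥-elim (i (here refl))
  chain z (there (there (here refl))) i = inj₁ (root (subst (Created Y ∈_) (sym knowA) (there (here refl))))

-- Frozen actors stay frozen

compact-compacted : ∀ {Φ x} → Released x ∈ Φ → Compacted Φ (removeRecv x (remove (Released x) (remove (Created x) Φ)))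
compact-compacted {Φ} {x} r = record
  { shrinks = compact-gain Φ
  ; keeps = λ q → [ inj₁ , (λ f → inj₂ (x , r , f)) ]′ (compact-lose Φ q)
  }

module _ {κ : Config} (inv : ConfigInv κ) where

  open ConfigInv inv

  idle-upd : ∀ {A C Φ s s'} → α κ A ≡ just (idle Φ) → α κ C ≡ just s → s ≢ idle Φ → setα κ C s' A ≡ just (idle Φ)
  idle-upd {s' = s'} αA αC ne =
    trans (upd-other (α κ) (just s') λ where refl → ne (just-injective (trans (sym αC) αA))) αA

  idle-other : ∀ {A C Φ s} → α κ A ≡ just (idle Φ) → A ≢ C → setα κ C s A ≡ just (idle Φ)
  idle-other {s = s} αA A≢C = trans (upd-other (α κ) (just s) A≢C) αA

  nothing-taken : ∀ {A C m ms₁ ms₂} → μ κ A ≡ [] → μ κ C ≡ ms₁ ++ m ∷ ms₂ → A ≢ C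
  nothing-taken {ms₁ = []} e took refl = case trans (sym e) took of λ ()
  nothing-taken {ms₁ = _ ∷ _} e took refl = case trans (sym e) took of λ ()

  -- Of the rules that change an idle actor, all but compaction consume one of its messages; the
  -- others change busy actors or create a new one.
  idle-step : ∀ {ℓ κ' A Φ} → Step κ ℓ κ' → α κ A ≡ just (idle Φ) → μ κ A ≡ [] →
    ∃[ Ψ ] α κ' A ≡ just (idle Ψ) × Compacted Φ Ψ
  idle-step {A = A} (spawn {C} {Φ = Φ} {B = B} {x} αC B∉ _ _ _) αA e =
    _ , trans (upd-other (setα κ C (busy (Activated (x ∶ C ⇒ B) ∷ Φ))) _ λ where refl → case trans (sym αA) (unusedAct B∉) of λ ())
          (idle-upd αA αC λ ())
      , compacted-refl
  idle-step (send _ αC _ _ _ _ _) αA e = _ , idle-upd αA αC (λ ()) , compacted-refl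
  idle-step (receive _ took _) αA e = _ , idle-other αA (nothing-taken e took) , compacted-refl
  idle-step (receive⊥ _ took) αA e = _ , idle-other αA (nothing-taken e took) , compacted-refl
  idle-step (idleStep αC) αA e = _ , idle-upd αA αC (λ ()) , compacted-refl
  idle-step (sendInfo αC _ _ _ _) αA e = _ , idle-upd αA αC (λ ()) , compacted-refl
  idle-step (infoStep _ took _) αA e = _ , idle-other αA (nothing-taken e took) , compacted-refl
  idle-step (sendRelease αC _ _ _ _) αA e = _ , idle-upd αA αC (λ ()) , compacted-refl
  idle-step (releaseStep _ took _) αA e = _ , idle-other αA (nothing-taken e took) , compacted-refl
  idle-step {A = A} (compaction {C} αC _ r) αA e with A ≟ C
  ... | no A≢C = _ , idle-other αA A≢C , compacted-refl
  ... | yes refl with refl ← just-injective (trans (sym αC) αA) = _ , upd-same (α κ) A _ , compact-compacted r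
  idle-step (snapshot _) αA e = _ , αA , compacted-refl
  idle-step (inStep _ _ _ _) αA e = _ , αA , compacted-refl
  idle-step (out _ _) αA e = _ , αA , compacted-refl
  idle-step (releaseOut _ _) αA e = _ , αA , compacted-refl
  idle-step (infoOut _ _) αA e = _ , αA , compacted-refl

  frozen-step : ∀ {ℓ κ' A Φ} → Step κ ℓ κ' → Frozen κ A Φ → μ κ A ≡ [] → Frozen κ' A Φ
  frozen-step st fr e with _ , αA , c ← idle-step st (Frozen.isIdle fr) e = record
    { isIdle = αA
    ; compacted = compacted-trans (Frozen.compacted fr) c
    ; finished = λ {x} r → finished-step (usedTok-step st) (Events.event inv st x) (Frozen.finished fr r)
    }

  frozen-start : ∀ {A Φ} → α κ A ≡ just (idle Φ) → Frozen κ A Φ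
  frozen-start {A} {Φ} αA = record
    { isIdle = αA
    ; compacted = compacted-refl
    ; finished = λ {x} r → dead⇒finished (refobs x) (at-target r)
    }
    where
    at-target : ∀ {x} → Released x ∈ Φ → Released x ∈ know κ (target x)
    at-target {x} r with r' ← subst (Released x ∈_) (sym (cong knowOf αA)) r with refl , _ ← releasedAt r' = r'

snapshotInv-χ : ∀ {κ κ' A Φ} → χ κ' ≡ χ κ → SnapshotInv κ A Φ → SnapshotInv κ' A Φ
snapshotInv-χ eq s = record
  { notExtern = subst (_ ∉_) (sym eq) notExtern
  ; releasedAt = λ r → proj₁ (releasedAt r) , subst (_ ∉_) (sym eq) (proj₂ (releasedAt r))
  }
  where open SnapshotInv s

snap-inversion : ∀ {κ ℓ κ' A Φ} → Step κ ℓ κ' → ℓ ≡ snap A Φ → α κ A ≡ just (idle Φ)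
snap-inversion (snapshot αA) refl = αA

-- Once every actor of the finalized set is frozen

record Quiescent (Q : Snapshots) (κ : Config) : Set where
  field
    configInv : ConfigInv κ
    snapshots : ∀ {A Φ} → Q A ≡ just Φ → SnapshotInv κ A Φ
    frozen    : ∀ {A Φ} → Q A ≡ just Φ → Frozen κ A Φ

frozen⇒evolved : ∀ {κ A Φ x} → Frozen κ A Φ → Evolved x (know κ A) Φ
frozen⇒evolved {Φ = Φ} {x} fr = subst (λ Ψ → Evolved x Ψ Φ) (sym (cong knowOf isIdle)) (compacted⇒evolved compacted)
  where open Frozen fr

module _ {Q : Snapshots} (fin : Finalized Q) where

  quiescent-empty : ∀ {κ B Φ} → Quiescent Q κ → Q B ≡ just Φ → μ κ B ≡ []
  quiescent-empty q QB = Quiescence.mailbox-empty configInv fin snapshots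
    (λ QA _ _ → frozen⇒evolved (frozen QA)) QB (frozen QB)
    where open Quiescent q

  quiescent-step : ∀ {κ ℓ κ'} → Step κ ℓ κ' → Quiescent Q κ → Quiescent Q κ'
  quiescent-step st q = record
    { configInv = StepInv.step-inv configInv st
    ; snapshots = λ QA → snapshotInv-χ (χ-step st) (snapshots QA)
    ; frozen = λ QA → frozen-step configInv st (frozen QA) (quiescent-empty q QA)
    }
    where open Quiescent q

  quiescent-reach : ∀ {κ κ'} → Reach κ κ' → Quiescent Q κ → Quiescent Q κ'
  quiescent-reach ε q = q
  quiescent-reach ((_ , st) ◅ r) q = quiescent-reach r (quiescent-step st q)

-- Along the execution up to the final time

module _ {A₀ E₀ : Actor} {x₀ y₀ : Token} (A≢E : A₀ ≢ E₀) (ex : Execution A₀ E₀ x₀ y₀) where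

  execution-inv : ∀ t → t ≤ len ex → ConfigInv (conf ex t)
  execution-inv zero _ = subst ConfigInv (sym (start ex)) (initial-inv A≢E)
  execution-inv (suc t) t<len = StepInv.step-inv (execution-inv t (<⇒≤ t<len)) (steps ex t t<len)

  execution-χ : ∀ t → t ≤ len ex → χ (conf ex t) ≡ χ (conf ex 0)
  execution-χ zero _ = refl
  execution-χ (suc t) t<len = trans (χ-step (steps ex t t<len)) (execution-χ t (<⇒≤ t<len))

  -- The two assumptions on `x` at time `t` carry over to every later time: tokens stay used, and an
  -- issued refob is never put into a message again.
  execution-evolved : ∀ k t → k + t ≤ len ex → ∀ {x} → Used (conf ex t) x → car (conf ex t) x ≡ 0 →
    Evolved x (know (conf ex t) (owner x)) (know (conf ex (k + t)) (owner x))
  execution-evolved zero t _ _ _ = evolved-refl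
  execution-evolved (suc k) t le {x} u c0 = evolved-trans (evolve e u c0)
    (subst (λ s → Evolved x (know (conf ex (suc t)) (owner x)) (know (conf ex s) (owner x))) (+-suc k t)
      (execution-evolved k (suc t) (≤-trans (≤-reflexive (+-suc k t)) le)
        (λ f → u (f ∘ usedTok-step st)) (car-step e u c0)))
    where
    t<len : t < len ex
    t<len = ≤-trans (s≤s (m≤n+m t k)) le
    st = steps ex t t<len
    e = Events.event (execution-inv t (<⇒≤ t<len)) st x

  module _ {tf : ℕ} (tf≤len : tf ≤ len ex) {Q : Snapshots} (taken : TakenBy ex Q tf) (fin : Finalized Q) where

    snapTime : ∀ {A Φ} → Q A ≡ just Φ → ℕ
    snapTime QA = proj₁ (taken _ _ QA)

    snapTime<len : ∀ {A Φ} (QA : Q A ≡ just Φ) → snapTime QA < len ex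
    snapTime<len QA = proj₁ (proj₂ (proj₂ (taken _ _ QA)))

    snapshot-idle : ∀ {A Φ} (QA : Q A ≡ just Φ) → α (conf ex (snapTime QA)) A ≡ just (idle Φ)
    snapshot-idle QA with t , _ , t<len , eq ← taken _ _ QA = snap-inversion (steps ex t t<len) eq

    snapshotInv-at : ∀ t → t ≤ len ex → ∀ {A Φ} → Q A ≡ just Φ → SnapshotInv (conf ex t) A Φ
    snapshotInv-at t t≤len {A} {Φ} QA = snapshotInv-χ {conf ex s} (trans (execution-χ t t≤len) (sym (execution-χ s s≤len))) (record
      { notExtern = Events.internal-actor inv αA
      ; releasedAt = λ {x} r → ConfigInv.releasedAt inv (subst (Released x ∈_) (sym (cong knowOf αA)) r)
      })
      where
      s = snapTime QA
      s≤len = <⇒≤ (snapTime<len QA)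
      inv = execution-inv s s≤len
      αA = snapshot-idle QA

    frozen-from-start : ∀ {t A Φ} (QA : Q A ≡ just Φ) → t ≤ len ex → snapTime QA ≡ t → Frozen (conf ex t) A Φ
    frozen-from-start QA le refl = frozen-start (execution-inv _ le) (snapshot-idle QA)

    -- Induction on `t` for all snapshots together. To pass from `t` to the next time, the mailbox
    -- must be empty at `t`, which requires `evolves` for every owner in `Q`: the induction
    -- hypothesis covers snapshots already taken, and the rest of the execution covers those still
    -- to come.
    frozen-at : ∀ t → t ≤ len ex → ∀ {A Φ} (QA : Q A ≡ just Φ) → snapTime QA ≤ t → Frozen (conf ex t) A Φ
    frozen-at zero le QA s≤ = frozen-from-start QA le (n≤0⇒n≡0 s≤)
    frozen-at (suc t) le {A} {Φ} QA s≤ with m≤n⇒m<n∨m≡n s≤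
    ... | inj₂ eq = frozen-from-start QA le eq
    ... | inj₁ (s≤s s≤t) = frozen-step (execution-inv t t≤) (steps ex t le) (frozen-at t t≤ QA s≤t)
      (Quiescence.mailbox-empty (execution-inv t t≤) fin (snapshotInv-at t t≤) evolves QA (frozen-at t t≤ QA s≤t))
      where
      t≤ : t ≤ len ex
      t≤ = <⇒≤ le
      evolves : ∀ {x Ψ} → Q (owner x) ≡ just Ψ → Used (conf ex t) x → car (conf ex t) x ≡ 0 →
        Evolved x (know (conf ex t) (owner x)) Ψ
      evolves {x} QB u c0 with ≤-total (snapTime QB) t
      ... | inj₁ s≤t = frozen⇒evolved (frozen-at t t≤ QB s≤t)
      ... | inj₂ t≤s = subst (Evolved x _) (trans (cong (λ n → know (conf ex n) (owner x)) (m∸n+n≡m t≤s)) (cong knowOf (snapshot-idle QB)))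
        (execution-evolved (snapTime QB ∸ t) t (≤-trans (≤-reflexive (m∸n+n≡m t≤s)) (<⇒≤ (snapTime<len QB))) u c0)

    quiescent-end : Quiescent Q (conf ex tf)
    quiescent-end = record
      { configInv = execution-inv tf tf≤len
      ; snapshots = snapshotInv-at tf tf≤len
      ; frozen = λ QA → frozen-at tf tf≤len QA (proj₁ (proj₂ (taken _ _ QA)))
      }

mainTheorem3 : ∀ (A₀ E₀ : Actor) (x₀ y₀ : Token) → A₀ ≢ E₀ → x₀ ≢ y₀ →
    (ex : Execution A₀ E₀ x₀ y₀) (tf : ℕ) → tf ≤ len ex →
    (Q : Snapshots) → TakenBy ex Q tf → Finalized Q →
    ∀ B → B ∈Q Q → Terminated (conf ex tf) B
mainTheorem3 A₀ E₀ x₀ y₀ A≢E _ ex tf tf≤len Q taken fin B (Φ , QB) =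
  (_ , Frozen.isIdle (Quiescent.frozen end QB)) ,
  λ where (_ , r , _ , _ , eq) → case trans (sym eq) (quiescent-empty fin (quiescent-reach fin r end) QB) of λ ()
  where
  end : Quiescent Q (conf ex tf)
  end = quiescent-end A≢E ex tf≤len taken fin
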